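{- The call-by-value catch/throw calculus has the Church–Rosser property: if $M_1$ and $M_2$ are equal in the congruence generated by its reduction rules, then there is a term $N$ with $M_1\to^*N$ and $M_2\to^*N$.
   Context: Call-by-value catch/throw calculus. Ordinary variables $x,y,z,\dots$ and continuation variables $k,l,\delta,\dots$ are disjoint. Terms: $M ::= x \mid \lambda x.M \mid MM \mid (M\ \mathsf{where}\ x:=M) \mid \varepsilon k.M \mid \mathsf{throw}_k M$, where $(L\ \mathsf{where}\ x:=M)$ means $\mathsf{let}\ x=M\ \mathsf{in}\ L$ ($x$ bound in $L$ only), $\varepsilon k$ binds $k$ (an exception block tagged $k$), and $\mathsf{throw}_k M$ raises $M$ to the block tagged $k$ ($k$ free). Terms are identified up to $\alpha$-conversion and the congruence generated by: $(L\ \mathsf{where}\ x:=(M\ \mathsf{where}\ y:=N))=((L\ \mathsf{where}\ x:=M)\ \mathsf{where}\ y:=N)$ if $y$ not free in $L$; $((\varepsilon k.M)\ \mathsf{where}\ x:=N)=\varepsilon k.(M\ \mathsf{where}\ x:=N)$ if $k$ not free in $N$; $((\mathsf{throw}_k M)\ \mathsf{where}\ x:=N)=\mathsf{throw}_k(M\ \mathsf{where}\ x:=N)$. Values $V$: variables and $\lambda$-abstractions; other terms are non-values ($N$ below). Reduction rules ($z$ fresh): $NM\to(zM\ \mathsf{where}\ z:=N)$; $VN\to(Vz\ \mathsf{where}\ z:=N)$; $(\lambda x.M)V\to(M\ \mathsf{where}\ x:=V)$; $(M\ \mathsf{where}\ x:=V)\to M\{V/x\}$; $\lambda x.Vx\to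 V$ ($x$ not free in $V$); $(x\ \mathsf{where}\ x:=M)\to M$; $\varepsilon\delta.M\to M$ ($\delta$ not free in $M$); $\varepsilon k.\mathsf{throw}_kM\to\varepsilon k.M$; $(M\ \mathsf{where}\ x:=\mathsf{throw}_kN)\to\mathsf{throw}_kN$; $\mathsf{throw}_l\mathsf{throw}_kN\to\mathsf{throw}_kN$; $(M\ \mathsf{where}\ x:=\varepsilon k.N)\to\varepsilon k.(M\ \mathsf{where}\ x:=N\{\mathsf{throw}_k\square\mapsto\mathsf{throw}_k(M\ \mathsf{where}\ x:=\square)\})$; $\mathsf{throw}_l\varepsilon k.M\to\mathsf{throw}_l(M\{l/k\})$; $\varepsilon l.\varepsilon k.M\to\varepsilon l.M\{l/k\}$. Here $\{\mathsf{throw}_k\square\mapsto\mathsf{throw}_k(M\ \mathsf{where}\ x:=\square)\}$ replaces recursively each subterm $\mathsf{throw}_kQ$ with $k$ free by $\mathsf{throw}_k(M\ \mathsf{where}\ x:=Q)$ (capture-avoiding), and $\{l/k\}$ replaces each such $\mathsf{throw}_kQ$ by $\mathsf{throw}_lQ$. $\to$ is the compatible closure, $\to^*$ its reflexive-transitive closure. -}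

module Defs where

open import Data.Bool using (if_then_else_)
open import Data.Fin using (Fin; zero; suc; lift; _≟_)
open import Data.Nat using (ℕ; suc)
open import Data.Product using (∃₂; _×_)
open import Data.Sum using (_⊎_)
open import Data.Vec.Functional using (_∷_)
open import Function using (id; _∘_)
open import Relation.Nullary using (¬_; does)

private variable
  m m′ n n′ : ℕ

infixl 7 _·_
infixl 6 _Where_
infix  8 ƛ_ ε_

-- Raw terms up to α-conversion: well-scoped de Bruijn syntax, with m ordinary
-- variables and n continuation variables in scope (two separate index spaces).
data Term (m n : ℕ) : Set where
  var     : Fin m → Term m n
  ƛ_      : Term (suc m) n → Term m n
  _·_     : Term m n → Term m n → Term m n
  -- L Where M  is  (L where x := M);  x is index zero of L and is not in scope in M.
  _Where_ : Term (suc m) n → Term m n → Term m n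
  ε_      : Term m (suc n) → Term m n
  throw   : Fin n → Term m n → Term m n

data Value {m n : ℕ} : Term m n → Set where
  var : (x : Fin m) → Value (var x)
  ƛ_  : (M : Term (suc m) n) → Value (ƛ M)

NonValue : Term m n → Set
NonValue M = ¬ Value M

rename : (Fin m → Fin m′) → Term m n → Term m′ n
rename ρ (var x)     = var (ρ x)
rename ρ (ƛ M)       = ƛ rename (lift 1 ρ) M
rename ρ (M · N)     = rename ρ M · rename ρ N
rename ρ (L Where M) = rename (lift 1 ρ) L Where rename ρ M
rename ρ (ε M)       = ε rename ρ M
rename ρ (throw k M) = throw k (rename ρ M)

renameᶜ : (Fin n → Fin n′) → Term m n → Term m n′
renameᶜ ρ (var x)     = var x
renameᶜ ρ (ƛ M)       = ƛ renameᶜ ρ M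
renameᶜ ρ (M · N)     = renameᶜ ρ M · renameᶜ ρ N
renameᶜ ρ (L Where M) = renameᶜ ρ L Where renameᶜ ρ M
renameᶜ ρ (ε M)       = ε renameᶜ (lift 1 ρ) M
renameᶜ ρ (throw k M) = throw (ρ k) (renameᶜ ρ M)

-- Side conditions "x (resp. k) not free in M" are expressed below by M being
-- of the form  weaken M  (resp. weakenᶜ M).
weaken : Term m n → Term (suc m) n
weaken = rename suc

weakenᶜ : Term m n → Term m (suc n)
weakenᶜ = renameᶜ suc

subst : (Fin m → Term m′ n) → Term m n → Term m′ n
subst σ (var x)     = σ x
subst σ (ƛ M)       = ƛ subst (var zero ∷ (weaken ∘ σ)) M
subst σ (M · N)     = subst σ M · subst σ N
subst σ (L Where M) = subst (var zero ∷ (weaken ∘ σ)) L Where subst σ M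
subst σ (ε M)       = ε subst (weakenᶜ ∘ σ) M
subst σ (throw k M) = throw k (subst σ M)

-- M [ V ]  is  M{V/x},  x being index zero of M.
_[_] : Term (suc m) n → Term m n → Term m n
M [ V ] = subst (V ∷ var) M

-- M [ l ]ᶜ  is  M{l/k},  k being continuation index zero of M.
_[_]ᶜ : Term m (suc n) → Fin n → Term m n
M [ l ]ᶜ = renameᶜ (l ∷ id) M

-- N ⟨throw k ↦ M ⟩  is  N{throw_k □ ↦ throw_k (M where x := □)},
-- x being index zero of M.
_⟨throw_↦_⟩ : Term m n → Fin n → Term (suc m) n → Term m n
var x       ⟨throw k ↦ M ⟩ = var x
(ƛ N)       ⟨throw k ↦ M ⟩ = ƛ (N ⟨throw k ↦ rename (lift 1 suc) M ⟩)
(N · P)     ⟨throw k ↦ M ⟩ = (N ⟨throw k ↦ M ⟩) · (P ⟨throw k ↦ M ⟩)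
(N Where P) ⟨throw k ↦ M ⟩ =
  (N ⟨throw k ↦ rename (lift 1 suc) M ⟩) Where (P ⟨throw k ↦ M ⟩)
(ε N)       ⟨throw k ↦ M ⟩ = ε (N ⟨throw suc k ↦ weakenᶜ M ⟩)
throw j Q   ⟨throw k ↦ M ⟩ =
  if does (j ≟ k) then throw j (M Where (Q ⟨throw k ↦ M ⟩))
                  else throw j (Q ⟨throw k ↦ M ⟩)

TermRel : Set₁
TermRel = ∀ {m n} → Term m n → Term m n → Set

_∪_ : TermRel → TermRel → TermRel
(R ∪ S) M N = R M N ⊎ S M N

data Compatible (R : TermRel) {m n : ℕ} : Term m n → Term m n → Set where
  base   : ∀ {M M′} → R M M′ → Compatible R M M′
  ƛ_     : ∀ {M M′} → Compatible R M M′ → Compatible R (ƛ M) (ƛ M′)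
  ·ˡ     : ∀ {M M′ N} → Compatible R M M′ → Compatible R (M · N) (M′ · N)
  ·ʳ     : ∀ {M N N′} → Compatible R N N′ → Compatible R (M · N) (M · N′)
  Whereˡ : ∀ {L L′ M} → Compatible R L L′ → Compatible R (L Where M) (L′ Where M)
  Whereʳ : ∀ {L M M′} → Compatible R M M′ → Compatible R (L Where M) (L Where M′)
  ε_     : ∀ {M M′} → Compatible R M M′ → Compatible R (ε M) (ε M′)
  throw  : ∀ {k M M′} → Compatible R M M′ → Compatible R (throw k M) (throw k M′)

data Congruence (R : TermRel) {m n : ℕ} : Term m n → Term m n → Set where
  base  : ∀ {M M′} → R M M′ → Congruence R M M′
  refl  : ∀ {M} → Congruence R M M
  sym   : ∀ {M N} → Congruence R M N → Congruence R N M
  trans : ∀ {M N P} → Congruence R M N → Congruence R N P → Congruence R M P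
  ƛ_    : ∀ {M M′} → Congruence R M M′ → Congruence R (ƛ M) (ƛ M′)
  _·_   : ∀ {M M′ N N′} →
          Congruence R M M′ → Congruence R N N′ → Congruence R (M · N) (M′ · N′)
  _Where_ : ∀ {L L′ M M′} →
          Congruence R L L′ → Congruence R M M′ → Congruence R (L Where M) (L′ Where M′)
  ε_    : ∀ {M M′} → Congruence R M M′ → Congruence R (ε M) (ε M′)
  throw : ∀ {k M M′} → Congruence R M M′ → Congruence R (throw k M) (throw k M′)

data Structural {m n : ℕ} : Term m n → Term m n → Set where
  where-where : ∀ L M N →
    Structural (L Where (M Where N)) ((rename (lift 1 suc) L Where M) Where N)
  ε-where : ∀ M N →
    Structural ((ε M) Where N) (ε (M Where weakenᶜ N))
  throw-where : ∀ k M N →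
    Structural (throw k M Where N) (throw k (M Where N))

data Rule {m n : ℕ} : Term m n → Term m n → Set where
  nonvalue-app : ∀ {N} M → NonValue N →
    Rule (N · M) ((var zero · weaken M) Where N)
  value-app : ∀ {V N} → Value V → NonValue N →
    Rule (V · N) ((weaken V · var zero) Where N)
  β : ∀ M {V} → Value V →
    Rule ((ƛ M) · V) (M Where V)
  where-value : ∀ M {V} → Value V →
    Rule (M Where V) (M [ V ])
  η : ∀ {V} → Value V →
    Rule (ƛ (weaken V · var zero)) V
  where-id : ∀ M →
    Rule (var zero Where M) M
  ε-unused : ∀ M →
    Rule (ε (weakenᶜ M)) M
  ε-throw : ∀ M →
    Rule (ε (throw zero M)) (ε M)
  where-throw : ∀ M k N →
    Rule (M Where throw k N) (throw k N)
  throw-throw : ∀ l k N →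
    Rule (throw l (throw k N)) (throw k N)
  where-ε : ∀ M N →
    Rule (M Where (ε N)) (ε (weakenᶜ M Where (N ⟨throw zero ↦ weakenᶜ M ⟩)))
  throw-ε : ∀ l M →
    Rule (throw l (ε M)) (throw l (M [ l ]ᶜ))
  ε-ε : ∀ M →
    Rule (ε (ε M)) (ε (M [ zero ]ᶜ))

infix 4 _≅_ _⟶_ _⟶*_ _≈_

-- The terms of the calculus are the ≅-classes of raw terms.
_≅_ : TermRel
_≅_ = Congruence Structural

-- One-step reduction between ≅-classes.
_⟶_ : TermRel
M ⟶ N = ∃₂ λ M′ N′ → M ≅ M′ × Compatible Rule M′ N′ × N′ ≅ N

-- Reflexive-transitive closure of ⟶ on ≅-classes, hence reflexive up to ≅.
data _⟶*_ {m n : ℕ} : Term m n → Term m n → Set where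
  done : ∀ {M N} → M ≅ N → M ⟶* N
  step : ∀ {M N P} → M ⟶ N → N ⟶* P → M ⟶* P

-- The congruence generated by the reduction rules, on ≅-classes.
_≈_ : TermRel
_≈_ = Congruence (Structural ∪ Rule)

{-# OPTIONS --safe #-}
-- The calculus is compared with a CPS target in A-normal form, whose commands are
-- ret k W  and  let x = W W′ in J  and whose functions abstract over a variable and a
-- return continuation.  Continuations are replaced hereditarily, so under the
-- translation ⟦_⟧ every structural equation and every rule except β and η becomes an
-- identity, and β and η become the only two target reductions, which are confluent.
-- Conversely every command J reads back as a term close J, contracted by the rules
-- where-id, ε-throw and ε-unused wherever they apply.  Then M ⟶* close ⟦ M ⟧, and
-- target reductions read back as reductions, so a common reduct J of ⟦ M₁ ⟧ and ⟦ M₂ ⟧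
-- yields the common reduct close J of M₁ and M₂.
module Submission where

open import Defs hiding (sym; trans)
open import Data.Bool using (if_then_else_; true; false)
open import Data.Fin using (Fin; zero; suc; lift; _≟_)
open import Data.Fin.Properties using (suc-injective)
open import Data.Nat using (ℕ; suc)
open import Data.Product using (∃-syntax; _×_; _,_; proj₁; proj₂; swap)
open import Data.Sum using (inj₁; inj₂)
open import Data.Vec.Functional using (_∷_)
open import Function using (id; _∘_)
open import Relation.Binary.Construct.Closure.ReflexiveTransitive using (Star; _◅_; _◅◅_; gmap) renaming (ε to [])
open import Relation.Binary.PropositionalEquality using (_≡_; refl; sym; trans; cong; cong₂; subst₂)
open import Relation.Nullary using (¬_; Dec; yes; no; does; contradiction)
open import Relation.Nullary.Decidable using (dec-true; dec-false)
import Relation.Binary.PropositionalEquality as ≡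

-- Source reduction only runs forward, and this dictates the form of `close`. A variable `x` is
-- irreducible, hence does not reduce to `ε (throw zero x)`, the literal reading of
-- `ret zero (atom x)`; nor does `x · y` reduce to `var zero Where (x · y)`. So the property M ⟶*
-- close ⟦ M ⟧ forces such administrative redexes to be contracted. Whether one is present is
-- decided by syntactic tests, and these have to be compatible with substitution and with further
-- reduction; hence the lemmas that reflect reductions along renamings of continuation variables. A
-- command is a chain of calls that ends in exactly one `ret`, whose continuation is read back as
-- one `throw` around the whole chain. Replacing that continuation by a let-body that ends elsewhere
-- would move this `throw`. Therefore a let-body is first made to return to the very continuation
-- that it replaces, and its true final continuation is restored afterwards by merging blocks with
-- `ε-ε` and `throw-ε`.

private variable
  m m′ m″ n n′ n″ : ℕ

-- Target calculus

data Sort : Set where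
  val cmd : Sort

-- app A B J  is  let x = A B in J,  x being index zero of J;  lam J  binds a variable
-- and the continuation to which its body J returns.
private variable
  s : Sort

data Exp : Sort → ℕ → ℕ → Set where
  atom : Fin m → Exp val m n
  lam  : Exp cmd (suc m) (suc n) → Exp val m n
  ret  : Fin n → Exp val m n → Exp cmd m n
  app  : Exp val m n → Exp val m n → Exp cmd (suc m) n → Exp cmd m n

Val Cmd : ℕ → ℕ → Set
Val = Exp val
Cmd = Exp cmd

ren : (Fin m → Fin m′) → (Fin n → Fin n′) → Exp s m n → Exp s m′ n′
ren ρ θ (atom x)    = atom (ρ x)
ren ρ θ (lam J)     = lam (ren (lift 1 ρ) (lift 1 θ) J)
ren ρ θ (ret k W)   = ret (θ k) (ren ρ θ W)
ren ρ θ (app A B J) = app (ren ρ θ A) (ren ρ θ B) (ren (lift 1 ρ) θ J)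

extv : (Fin m → Val m′ n) → Fin (suc m) → Val (suc m′) n
extv σ = atom zero ∷ (ren suc id ∘ σ)

extvᶜ : (Fin m → Val m′ n) → Fin (suc m) → Val (suc m′) (suc n)
extvᶜ σ = atom zero ∷ (ren suc suc ∘ σ)

-- Continuations are only renamed here, so no redex `(x. J) W` arises. `sub` applies this function
-- to `κ k`, which is not a subterm of its argument, and so stays structurally recursive.
subv : (Fin m → Val m′ n′) → (Fin n → Fin n′) → Exp s m n → Exp s m′ n′
subv σ θ (atom x)    = σ x
subv σ θ (lam J)     = lam (subv (extvᶜ σ) (lift 1 θ) J)
subv σ θ (ret k W)   = ret (θ k) (subv σ θ W)
subv σ θ (app A B J) = app (subv σ θ A) (subv σ θ B) (subv (extv σ) θ J)

extk : (Fin n → Cmd (suc m) n′) → Fin n → Cmd (suc (suc m)) n′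
extk κ = ren (lift 1 suc) id ∘ κ

extkᶜ : (Fin n → Cmd (suc m) n′) → Fin (suc n) → Cmd (suc (suc m)) (suc n′)
extkᶜ κ = ret zero (atom zero) ∷ (ren (lift 1 suc) suc ∘ κ)

-- Substitution of values for variables and of let-bodies for continuations;
-- the redex  (x. J) W  that arises at  ret k W  is contracted on the fly.
sub : (Fin m → Val m′ n′) → (Fin n → Cmd (suc m′) n′) → Exp s m n → Exp s m′ n′
sub σ κ (atom x)    = σ x
sub σ κ (lam J)     = lam (sub (extvᶜ σ) (extkᶜ κ) J)
sub σ κ (ret k W)   = subv (sub σ κ W ∷ atom) id (κ k)
sub σ κ (app A B J) = app (sub σ κ A) (sub σ κ B) (sub (extv σ) (extk κ) J)

-- The η-expansion `x. ret (θ k) x` of the continuation `θ k`; by `sub-retk`, substituting it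
-- amounts to renaming.
retk : (Fin n → Fin n′) → Fin n → Cmd (suc m) n′
retk θ k = ret (θ k) (atom zero)

-- Laws of renaming and substitution in the target

cong₃ : ∀ {A B C D : Set} (f : A → B → C → D) {a a′ b b′ c c′} →
        a ≡ a′ → b ≡ b′ → c ≡ c′ → f a b c ≡ f a′ b′ c′
cong₃ f refl refl refl = refl

lift-∘ : {f : Fin m → Fin m′} {g : Fin m′ → Fin m″} {h : Fin m → Fin m″} →
         (∀ x → g (f x) ≡ h x) → ∀ x → lift 1 g (lift 1 f x) ≡ lift 1 h x
lift-∘ p zero    = refl
lift-∘ p (suc x) = cong suc (p x)

lift-id : {f : Fin m → Fin m} → (∀ x → f x ≡ x) → ∀ x → lift 1 f x ≡ x
lift-id p zero    = refl
lift-id p (suc x) = cong suc (p x)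

ren-id : {ρ : Fin m → Fin m} {θ : Fin n → Fin n} →
         (∀ x → ρ x ≡ x) → (∀ k → θ k ≡ k) → (E : Exp s m n) → ren ρ θ E ≡ E
ren-id p q (atom x)    = cong atom (p x)
ren-id p q (lam J)     = cong lam (ren-id (lift-id p) (lift-id q) J)
ren-id p q (ret k W)   = cong₂ ret (q k) (ren-id p q W)
ren-id p q (app A B J) = cong₃ app (ren-id p q A) (ren-id p q B) (ren-id (lift-id p) q J)

ren-ren : {ρ₁ : Fin m → Fin m′} {ρ₂ : Fin m′ → Fin m″} {ρ₃ : Fin m → Fin m″}
          {θ₁ : Fin n → Fin n′} {θ₂ : Fin n′ → Fin n″} {θ₃ : Fin n → Fin n″} →
          (∀ x → ρ₂ (ρ₁ x) ≡ ρ₃ x) → (∀ k → θ₂ (θ₁ k) ≡ θ₃ k) →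
          (E : Exp s m n) → ren ρ₂ θ₂ (ren ρ₁ θ₁ E) ≡ ren ρ₃ θ₃ E
ren-ren p q (atom x)    = cong atom (p x)
ren-ren p q (lam J)     = cong lam (ren-ren (lift-∘ p) (lift-∘ q) J)
ren-ren p q (ret k W)   = cong₂ ret (q k) (ren-ren p q W)
ren-ren p q (app A B J) = cong₃ app (ren-ren p q A) (ren-ren p q B) (ren-ren (lift-∘ p) q J)

ren-comm : ∀ {a b}
           {ρ₁ : Fin m → Fin m′} {ρ₂ : Fin m′ → Fin m″} {ρ₃ : Fin m → Fin a} {ρ₄ : Fin a → Fin m″}
           {θ₁ : Fin n → Fin n′} {θ₂ : Fin n′ → Fin n″} {θ₃ : Fin n → Fin b} {θ₄ : Fin b → Fin n″} →
           (∀ x → ρ₂ (ρ₁ x) ≡ ρ₄ (ρ₃ x)) → (∀ k → θ₂ (θ₁ k) ≡ θ₄ (θ₃ k)) →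
           (E : Exp s m n) → ren ρ₂ θ₂ (ren ρ₁ θ₁ E) ≡ ren ρ₄ θ₄ (ren ρ₃ θ₃ E)
ren-comm p q E = trans (ren-ren p q E) (sym (ren-ren (λ _ → refl) (λ _ → refl) E))

subv-ren : {ρ : Fin m → Fin m′} {σ : Fin m′ → Val m″ n″} {τ : Fin m → Val m″ n″}
           {θ₁ : Fin n → Fin n′} {θ₂ : Fin n′ → Fin n″} {θ₃ : Fin n → Fin n″} →
           (∀ x → σ (ρ x) ≡ τ x) → (∀ k → θ₂ (θ₁ k) ≡ θ₃ k) →
           (E : Exp s m n) → subv σ θ₂ (ren ρ θ₁ E) ≡ subv τ θ₃ E
subv-ren p q (atom x)    = p x
subv-ren p q (lam J)     =
  cong lam (subv-ren (λ { zero → refl ; (suc x) → cong (ren suc suc) (p x) }) (lift-∘ q) J)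
subv-ren p q (ret k W)   = cong₂ ret (q k) (subv-ren p q W)
subv-ren p q (app A B J) =
  cong₃ app (subv-ren p q A) (subv-ren p q B)
    (subv-ren (λ { zero → refl ; (suc x) → cong (ren suc id) (p x) }) q J)

-- Inserting an identity renaming makes this an instance of `subv-ren`, whose hypotheses are
-- pointwise. `ren-ext` and `sub-ext` follow the same pattern.
subv-ext : {σ τ : Fin m → Val m′ n′} {θ : Fin n → Fin n′} → (∀ x → σ x ≡ τ x) →
           (E : Exp s m n) → subv σ θ E ≡ subv τ θ E
subv-ext {σ = σ} {θ = θ} p E = trans
  (cong (subv σ θ) (sym (ren-id (λ _ → refl) (λ _ → refl) E))) (subv-ren p (λ _ → refl) E)

ren-subv : {σ : Fin m → Val m′ n′} {ρ : Fin m′ → Fin m″} {τ : Fin m → Val m″ n″}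
           {θ₁ : Fin n → Fin n′} {θ₂ : Fin n′ → Fin n″} {θ₃ : Fin n → Fin n″} →
           (∀ x → ren ρ θ₂ (σ x) ≡ τ x) → (∀ k → θ₂ (θ₁ k) ≡ θ₃ k) →
           (E : Exp s m n) → ren ρ θ₂ (subv σ θ₁ E) ≡ subv τ θ₃ E
ren-subv p q (atom x)    = p x
ren-subv {σ = σ} p q (lam J) =
  cong lam (ren-subv (λ { zero → refl
                        ; (suc x) → trans (ren-comm (λ _ → refl) (λ _ → refl) (σ x))
                                          (cong (ren suc suc) (p x)) })
                     (lift-∘ q) J)
ren-subv p q (ret k W)   = cong₂ ret (q k) (ren-subv p q W)
ren-subv {σ = σ} p q (app A B J) =
  cong₃ app (ren-subv p q A) (ren-subv p q B)
    (ren-subv (λ { zero → refl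
                 ; (suc x) → trans (ren-comm (λ _ → refl) (λ _ → refl) (σ x))
                                   (cong (ren suc id) (p x)) })
              q J)

subv-ren-comm : ∀ {a b}
  {ρ : Fin m → Fin m′} {σ′ : Fin m′ → Val m″ n″} {σ : Fin m → Val a b} {ρ′ : Fin a → Fin m″}
  {θ₁ : Fin n → Fin n′} {θ₂ : Fin n′ → Fin n″} {θ₃ : Fin n → Fin b} {θ₄ : Fin b → Fin n″} →
  (∀ x → σ′ (ρ x) ≡ ren ρ′ θ₄ (σ x)) → (∀ k → θ₂ (θ₁ k) ≡ θ₄ (θ₃ k)) →
  (E : Exp s m n) → subv σ′ θ₂ (ren ρ θ₁ E) ≡ ren ρ′ θ₄ (subv σ θ₃ E)
subv-ren-comm p q E = trans (subv-ren p q E) (sym (ren-subv (λ _ → refl) (λ _ → refl) E))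

subv-subv : {σ₁ : Fin m → Val m′ n′} {σ₂ : Fin m′ → Val m″ n″} {σ₃ : Fin m → Val m″ n″}
            {θ₁ : Fin n → Fin n′} {θ₂ : Fin n′ → Fin n″} {θ₃ : Fin n → Fin n″} →
            (∀ x → subv σ₂ θ₂ (σ₁ x) ≡ σ₃ x) → (∀ k → θ₂ (θ₁ k) ≡ θ₃ k) →
            (E : Exp s m n) → subv σ₂ θ₂ (subv σ₁ θ₁ E) ≡ subv σ₃ θ₃ E
subv-subv p q (atom x) = p x
subv-subv {σ₁ = σ₁} p q (lam J) =
  cong lam (subv-subv (λ { zero → refl
                         ; (suc x) → trans (subv-ren-comm (λ _ → refl) (λ _ → refl) (σ₁ x))
                                           (cong (ren suc suc) (p x)) })
                      (lift-∘ q) J)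
subv-subv p q (ret k W) = cong₂ ret (q k) (subv-subv p q W)
subv-subv {σ₁ = σ₁} p q (app A B J) =
  cong₃ app (subv-subv p q A) (subv-subv p q B)
    (subv-subv (λ { zero → refl
                  ; (suc x) → trans (subv-ren-comm (λ _ → refl) (λ _ → refl) (σ₁ x))
                                    (cong (ren suc id) (p x)) })
               q J)

subv-atom : {σ : Fin m → Val m′ n′} {ρ : Fin m → Fin m′} {θ θ′ : Fin n → Fin n′} →
            (∀ x → σ x ≡ atom (ρ x)) → (∀ k → θ k ≡ θ′ k) →
            (E : Exp s m n) → subv σ θ E ≡ ren ρ θ′ E
subv-atom p q (atom x)    = p x
subv-atom p q (lam J)     =
  cong lam (subv-atom (λ { zero → refl ; (suc x) → cong (ren suc suc) (p x) })
                      (λ { zero → refl ; (suc k) → cong suc (q k) }) J)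
subv-atom p q (ret k W)   = cong₂ ret (q k) (subv-atom p q W)
subv-atom p q (app A B J) =
  cong₃ app (subv-atom p q A) (subv-atom p q B)
    (subv-atom (λ { zero → refl ; (suc x) → cong (ren suc id) (p x) }) q J)

subv-id : {σ : Fin m → Val m n} → (∀ x → σ x ≡ atom x) → (E : Exp s m n) → subv σ id E ≡ E
subv-id p E = trans (subv-atom p (λ _ → refl) E) (ren-id (λ _ → refl) (λ _ → refl) E)

subv-weaken : {V : Val m n} (E : Exp s m n) → subv (V ∷ atom) id (ren suc id E) ≡ E
subv-weaken E = trans (subv-ren (λ _ → refl) (λ _ → refl) E) (subv-id (λ _ → refl) E)

sub-ren : {ρ : Fin m → Fin m′} {σ : Fin m′ → Val m″ n″} {τ : Fin m → Val m″ n″}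
          {θ : Fin n → Fin n′} {κ : Fin n′ → Cmd (suc m″) n″} {κ′ : Fin n → Cmd (suc m″) n″} →
          (∀ x → σ (ρ x) ≡ τ x) → (∀ k → κ (θ k) ≡ κ′ k) →
          (E : Exp s m n) → sub σ κ (ren ρ θ E) ≡ sub τ κ′ E
sub-ren p q (atom x)  = p x
sub-ren p q (lam J)   =
  cong lam (sub-ren (λ { zero → refl ; (suc x) → cong (ren suc suc) (p x) })
                    (λ { zero → refl ; (suc k) → cong (ren (lift 1 suc) suc) (q k) }) J)
sub-ren p q (ret k W) = cong₂ (λ V J → subv (V ∷ atom) id J) (sub-ren p q W) (q k)
sub-ren p q (app A B J) =
  cong₃ app (sub-ren p q A) (sub-ren p q B)
    (sub-ren (λ { zero → refl ; (suc x) → cong (ren suc id) (p x) })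
             (λ k → cong (ren (lift 1 suc) id) (q k)) J)

lift-suc-comm : {ρ : Fin m → Fin m′} → ∀ x →
                lift 1 (lift 1 ρ) (lift 1 suc x) ≡ lift 1 suc (lift 1 ρ x)
lift-suc-comm zero    = refl
lift-suc-comm (suc x) = refl

ren-sub : {σ : Fin m → Val m′ n′} {ρ : Fin m′ → Fin m″} {τ : Fin m → Val m″ n″}
          {κ : Fin n → Cmd (suc m′) n′} {θ : Fin n′ → Fin n″} {κ′ : Fin n → Cmd (suc m″) n″} →
          (∀ x → ren ρ θ (σ x) ≡ τ x) → (∀ k → ren (lift 1 ρ) θ (κ k) ≡ κ′ k) →
          (E : Exp s m n) → ren ρ θ (sub σ κ E) ≡ sub τ κ′ E
ren-sub p q (atom x) = p x
ren-sub {σ = σ} {κ = κ} p q (lam J) =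
  cong lam (ren-sub (λ { zero → refl
                       ; (suc x) → trans (ren-comm (λ _ → refl) (λ _ → refl) (σ x))
                                         (cong (ren suc suc) (p x)) })
                    (λ { zero → refl
                       ; (suc k) → trans (ren-comm lift-suc-comm (λ _ → refl) (κ k))
                                         (cong (ren (lift 1 suc) suc) (q k)) }) J)
ren-sub {ρ = ρ} {κ = κ} {θ} p q (ret k W) = trans
  (sym (subv-ren-comm (λ { zero → sym (ren-sub p q W) ; (suc x) → refl }) (λ _ → refl) (κ k)))
  (cong (subv _ id) (q k))
ren-sub {σ = σ} {κ = κ} p q (app A B J) =
  cong₃ app (ren-sub p q A) (ren-sub p q B)
    (ren-sub (λ { zero → refl
                ; (suc x) → trans (ren-comm (λ _ → refl) (λ _ → refl) (σ x))
                                  (cong (ren suc id) (p x)) })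
             (λ k → trans (ren-comm lift-suc-comm (λ _ → refl) (κ k))
                          (cong (ren (lift 1 suc) id) (q k))) J)

sub-ren-comm : ∀ {a b}
  {ρ : Fin m → Fin m′} {σ′ : Fin m′ → Val m″ n″} {σ : Fin m → Val a b} {ρ′ : Fin a → Fin m″}
  {θ : Fin n → Fin n′} {κ′ : Fin n′ → Cmd (suc m″) n″} {κ : Fin n → Cmd (suc a) b} {θ′ : Fin b → Fin n″} →
  (∀ x → σ′ (ρ x) ≡ ren ρ′ θ′ (σ x)) → (∀ k → κ′ (θ k) ≡ ren (lift 1 ρ′) θ′ (κ k)) →
  (E : Exp s m n) → sub σ′ κ′ (ren ρ θ E) ≡ ren ρ′ θ′ (sub σ κ E)
sub-ren-comm p q E = trans (sub-ren p q E) (sym (ren-sub (λ _ → refl) (λ _ → refl) E))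

sub-subv : {τ : Fin m → Val m′ n′} {σ : Fin m′ → Val m″ n″} {σ′ : Fin m → Val m″ n″}
           {θ : Fin n → Fin n′} {κ : Fin n′ → Cmd (suc m″) n″} {κ′ : Fin n → Cmd (suc m″) n″} →
           (∀ x → sub σ κ (τ x) ≡ σ′ x) → (∀ k → κ (θ k) ≡ κ′ k) →
           (E : Exp s m n) → sub σ κ (subv τ θ E) ≡ sub σ′ κ′ E
sub-subv p q (atom x) = p x
sub-subv {τ = τ} p q (lam J) =
  cong lam (sub-subv (λ { zero → refl
                        ; (suc x) → trans (sub-ren-comm (λ _ → refl) (λ _ → refl) (τ x))
                                          (cong (ren suc suc) (p x)) })
                     (λ { zero → refl ; (suc k) → cong (ren (lift 1 suc) suc) (q k) }) J)
sub-subv p q (ret k W) = cong₂ (λ V J → subv (V ∷ atom) id J) (sub-subv p q W) (q k)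
sub-subv {τ = τ} p q (app A B J) =
  cong₃ app (sub-subv p q A) (sub-subv p q B)
    (sub-subv (λ { zero → refl
                 ; (suc x) → trans (sub-ren-comm (λ _ → refl) (λ _ → refl) (τ x))
                                   (cong (ren suc id) (p x)) })
              (λ k → cong (ren (lift 1 suc) id) (q k)) J)

subv-sub : {σ : Fin m → Val m′ n′} {τ : Fin m′ → Val m″ n″} {σ′ : Fin m → Val m″ n″}
           {κ : Fin n → Cmd (suc m′) n′} {θ : Fin n′ → Fin n″} {κ′ : Fin n → Cmd (suc m″) n″} →
           (∀ x → subv τ θ (σ x) ≡ σ′ x) → (∀ k → subv (extv τ) θ (κ k) ≡ κ′ k) →
           (E : Exp s m n) → subv τ θ (sub σ κ E) ≡ sub σ′ κ′ E
subv-sub p q (atom x) = p x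
subv-sub {σ = σ} {τ} {κ = κ} p q (lam J) =
  cong lam (subv-sub (λ { zero → refl
                        ; (suc x) → trans (subv-ren-comm (λ _ → refl) (λ _ → refl) (σ x))
                                          (cong (ren suc suc) (p x)) })
                     (λ { zero → refl
                        ; (suc k) → trans
                            (subv-ren-comm (λ { zero → refl
                                              ; (suc x) → ren-comm (λ _ → refl) (λ _ → refl) (τ x) })
                                           (λ _ → refl) (κ k))
                            (cong (ren (lift 1 suc) suc) (q k)) }) J)
subv-sub {τ = τ} {κ = κ} p q (ret k W) = trans
  (subv-subv (λ { zero → subv-sub p q W ; (suc x) → refl }) (λ _ → refl) (κ k))
  (trans
    (sym (subv-subv {σ₁ = extv τ} {σ₂ = sub _ _ W ∷ atom} {σ₃ = sub _ _ W ∷ τ}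
                    (λ { zero → refl ; (suc x) → subv-weaken (τ x) })
                    (λ _ → refl) (κ k)))
    (cong (subv _ id) (q k)))
subv-sub {σ = σ} {τ} {κ = κ} p q (app A B J) =
  cong₃ app (subv-sub p q A) (subv-sub p q B)
    (subv-sub (λ { zero → refl
                 ; (suc x) → trans (subv-ren-comm (λ _ → refl) (λ _ → refl) (σ x))
                                   (cong (ren suc id) (p x)) })
              (λ k → trans
                 (subv-ren-comm (λ { zero → refl
                                   ; (suc x) → ren-comm (λ _ → refl) (λ _ → refl) (τ x) })
                                (λ _ → refl) (κ k))
                 (cong (ren (lift 1 suc) id) (q k))) J)

sub-sub : {σ₁ : Fin m → Val m′ n′} {σ₂ : Fin m′ → Val m″ n″} {σ₃ : Fin m → Val m″ n″}
          {κ₁ : Fin n → Cmd (suc m′) n′} {κ₂ : Fin n′ → Cmd (suc m″) n″} {κ₃ : Fin n → Cmd (suc m″) n″} →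
          (∀ x → sub σ₂ κ₂ (σ₁ x) ≡ σ₃ x) → (∀ k → sub (extv σ₂) (extk κ₂) (κ₁ k) ≡ κ₃ k) →
          (E : Exp s m n) → sub σ₂ κ₂ (sub σ₁ κ₁ E) ≡ sub σ₃ κ₃ E
sub-sub p q (atom x) = p x
sub-sub {σ₁ = σ₁} {σ₂} {κ₁ = κ₁} {κ₂} p q (lam J) =
  cong lam (sub-sub (λ { zero → refl
                       ; (suc x) → trans (sub-ren-comm (λ _ → refl) (λ _ → refl) (σ₁ x))
                                         (cong (ren suc suc) (p x)) })
                    (λ { zero → refl
                       ; (suc k) → trans
                           (sub-ren-comm
                             (λ { zero → refl ; (suc x) → ren-comm (λ _ → refl) (λ _ → refl) (σ₂ x) })
                             (λ l → ren-comm (λ { zero → refl ; (suc x) → refl }) (λ _ → refl) (κ₂ l))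
                             (κ₁ k))
                           (cong (ren (lift 1 suc) suc) (q k)) }) J)
-- Both sides become one substitution in `κ₁ k`, with the image of `W` for the let-bound variable
-- and `σ₂` for the others: the left by `sub-subv`, the right by `subv-sub`.
sub-sub {σ₂ = σ₂} {κ₁ = κ₁} {κ₂} p q (ret k W) = trans
  (sub-subv (λ { zero → sub-sub p q W ; (suc x) → refl }) (λ _ → refl) (κ₁ k))
  (trans
    (sym (subv-sub {σ = extv σ₂} {τ = sub _ _ W ∷ atom} {σ′ = sub _ _ W ∷ σ₂}
           (λ { zero → refl ; (suc x) → subv-weaken (σ₂ x) })
           (λ l → trans (subv-ren {τ = atom} (λ { zero → refl ; (suc x) → refl }) (λ _ → refl) (κ₂ l))
                        (subv-id (λ _ → refl) (κ₂ l)))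
           (κ₁ k)))
    (cong (subv _ id) (q k)))
sub-sub {σ₁ = σ₁} {σ₂} {κ₁ = κ₁} {κ₂} p q (app A B J) =
  cong₃ app (sub-sub p q A) (sub-sub p q B)
    (sub-sub (λ { zero → refl
                ; (suc x) → trans (sub-ren-comm (λ _ → refl) (λ _ → refl) (σ₁ x))
                                  (cong (ren suc id) (p x)) })
             (λ k → trans
                (sub-ren-comm
                  (λ { zero → refl ; (suc x) → ren-comm (λ _ → refl) (λ _ → refl) (σ₂ x) })
                  (λ l → ren-comm (λ { zero → refl ; (suc x) → refl }) (λ _ → refl) (κ₂ l))
                  (κ₁ k))
                (cong (ren (lift 1 suc) id) (q k))) J)

sub-retk : {σ τ : Fin m → Val m′ n′} {κ : Fin n → Cmd (suc m′) n′} {θ : Fin n → Fin n′} →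
           (∀ x → σ x ≡ τ x) → (∀ k → κ k ≡ retk θ k) →
           (E : Exp s m n) → sub σ κ E ≡ subv τ θ E
sub-retk p q (atom x)  = p x
sub-retk p q (lam J)   =
  cong lam (sub-retk (λ { zero → refl ; (suc x) → cong (ren suc suc) (p x) })
                     (λ { zero → refl ; (suc k) → cong (ren (lift 1 suc) suc) (q k) }) J)
sub-retk p q (ret k W) = cong₂ (λ V J → subv (V ∷ atom) id J) (sub-retk p q W) (q k)
sub-retk p q (app A B J) =
  cong₃ app (sub-retk p q A) (sub-retk p q B)
    (sub-retk (λ { zero → refl ; (suc x) → cong (ren suc id) (p x) })
              (λ k → cong (ren (lift 1 suc) id) (q k)) J)

sub-as-ren : {σ : Fin m → Val m′ n′} {ρ : Fin m → Fin m′} {κ : Fin n → Cmd (suc m′) n′} {θ : Fin n → Fin n′} →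
             (∀ x → σ x ≡ atom (ρ x)) → (∀ k → κ k ≡ retk θ k) →
             (E : Exp s m n) → sub σ κ E ≡ ren ρ θ E
sub-as-ren p q E = trans (sub-retk (λ _ → refl) q E) (subv-atom p (λ _ → refl) E)

sub-id : {σ : Fin m → Val m n} {κ : Fin n → Cmd (suc m) n} →
         (∀ x → σ x ≡ atom x) → (∀ k → κ k ≡ retk id k) → (E : Exp s m n) → sub σ κ E ≡ E
sub-id p q E = trans (sub-as-ren p q E) (ren-id (λ _ → refl) (λ _ → refl) E)

-- Confluence of the target

contract : Cmd (suc m) (suc n) → Val m n → Cmd (suc m) n → Cmd m n
contract J W K = sub (W ∷ atom) (K ∷ retk id) J

infix 4 _⇉_ _⇉*_

-- Parallel reduction. Expressions that are not in constructor form, the function of an η-redex and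
-- the result of β, are tied by equations, so that steps can be analysed by pattern matching.
data _⇉_ : Exp s m n → Exp s m n → Set where
  atom : ∀ {x} → _⇉_ {val} {m} {n} (atom x) (atom x)
  lam  : {J J′ : Cmd (suc m) (suc n)} → J ⇉ J′ → lam J ⇉ lam J′
  η    : {A : Val (suc m) (suc n)} {W W′ : Val m n} → A ≡ ren suc suc W → W ⇉ W′ →
         lam (app A (atom zero) (ret zero (atom zero))) ⇉ W′
  ret  : ∀ {k} {W W′ : Val m n} → W ⇉ W′ → ret k W ⇉ ret k W′
  app  : {A A′ B B′ : Val m n} {K K′ : Cmd (suc m) n} →
         A ⇉ A′ → B ⇉ B′ → K ⇉ K′ → app A B K ⇉ app A′ B′ K′
  β    : {J J′ : Cmd (suc m) (suc n)} {W W′ : Val m n} {K K′ : Cmd (suc m) n} {X : Cmd m n} →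
         J ⇉ J′ → W ⇉ W′ → K ⇉ K′ → X ≡ contract J′ W′ K′ → app (lam J) W K ⇉ X

_⇉*_ : Exp s m n → Exp s m n → Set
_⇉*_ = Star _⇉_

⇉-refl : (E : Exp s m n) → E ⇉ E
⇉-refl (atom x)    = atom
⇉-refl (lam J)     = lam (⇉-refl J)
⇉-refl (ret k W)   = ret (⇉-refl W)
⇉-refl (app A B K) = app (⇉-refl A) (⇉-refl B) (⇉-refl K)

subv-lift-suc : (E : Exp s (suc m) n) → subv (atom zero ∷ atom) id (ren (lift 1 suc) id E) ≡ E
subv-lift-suc E = trans
  (subv-ren {τ = atom} (λ { zero → refl ; (suc x) → refl }) (λ _ → refl) E)
  (subv-id (λ _ → refl) E)

sub-weaken : {W : Val m n} {K : Cmd (suc m) n} (E : Exp s m n) →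
             sub (W ∷ atom) (K ∷ retk id) (ren suc suc E) ≡ E
sub-weaken E = trans (sub-ren (λ _ → refl) (λ _ → refl) E) (sub-id (λ _ → refl) (λ _ → refl) E)

ren-contract : {ρ : Fin m → Fin m′} {θ : Fin n → Fin n′} (J : Cmd (suc m) (suc n)) (W : Val m n) (K : Cmd (suc m) n) →
  ren ρ θ (contract J W K) ≡ contract (ren (lift 1 ρ) (lift 1 θ) J) (ren ρ θ W) (ren (lift 1 ρ) θ K)
ren-contract J W K =
  sym (sub-ren-comm (λ { zero → refl ; (suc x) → refl }) (λ { zero → refl ; (suc k) → refl }) J)

subv-contract : {σ : Fin m → Val m′ n′} {θ : Fin n → Fin n′} (J : Cmd (suc m) (suc n)) (W : Val m n) (K : Cmd (suc m) n) →
  subv σ θ (contract J W K) ≡ contract (subv (extvᶜ σ) (lift 1 θ) J) (subv σ θ W) (subv (extv σ) θ K)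
subv-contract {σ = σ} {θ} J W K = trans
  (subv-sub {σ′ = subv σ θ W ∷ σ} {κ′ = subv (extv σ) θ K ∷ retk θ}
            (λ { zero → refl ; (suc x) → refl }) (λ { zero → refl ; (suc k) → refl }) J)
  (sym (sub-subv (λ { zero → refl ; (suc x) → sub-weaken (σ x) })
                 (λ { zero → refl ; (suc k) → refl }) J))

sub-contract : {σ : Fin m → Val m′ n′} {κ : Fin n → Cmd (suc m′) n′} (J : Cmd (suc m) (suc n)) (W : Val m n) (K : Cmd (suc m) n) →
  sub σ κ (contract J W K) ≡ contract (sub (extvᶜ σ) (extkᶜ κ) J) (sub σ κ W) (sub (extv σ) (extk κ) K)
sub-contract {σ = σ} {κ} J W K = trans
  (sub-sub {σ₃ = sub σ κ W ∷ σ} {κ₃ = sub (extv σ) (extk κ) K ∷ κ}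
           (λ { zero → refl ; (suc x) → refl })
           (λ { zero → refl ; (suc k) → subv-lift-suc (κ k) }) J)
  (sym (sub-sub (λ { zero → refl ; (suc x) → sub-weaken (σ x) })
                (λ { zero → subv-lift-suc (sub (extv σ) (extk κ) K)
                   ; (suc k) → trans (sub-ren {τ = atom} (λ { zero → refl ; (suc x) → refl }) (λ _ → refl) (κ k))
                                     (sub-id (λ _ → refl) (λ _ → refl) (κ k)) }) J))

ren-⇉ : {E E′ : Exp s m n} (ρ : Fin m → Fin m′) (θ : Fin n → Fin n′) → E ⇉ E′ → ren ρ θ E ⇉ ren ρ θ E′
ren-⇉ ρ θ atom        = atom
ren-⇉ ρ θ (lam d)     = lam (ren-⇉ _ _ d)
ren-⇉ ρ θ (η {W = W} refl d) = η (ren-comm (λ _ → refl) (λ _ → refl) W) (ren-⇉ ρ θ d)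
ren-⇉ ρ θ (ret d)     = ret (ren-⇉ ρ θ d)
ren-⇉ ρ θ (app a b d) = app (ren-⇉ ρ θ a) (ren-⇉ ρ θ b) (ren-⇉ _ θ d)
ren-⇉ ρ θ (β {J′ = J} {W′ = W} {K′ = K} d w k refl) =
  β (ren-⇉ _ _ d) (ren-⇉ ρ θ w) (ren-⇉ _ θ k) (ren-contract J W K)

ext-⇉ : {σ σ′ : Fin m → Val m′ n′} (θ : Fin n′ → Fin n″) → (∀ x → σ x ⇉ σ′ x) →
        ∀ x → (atom zero ∷ (ren suc θ ∘ σ)) x ⇉ (atom zero ∷ (ren suc θ ∘ σ′)) x
ext-⇉ θ p zero    = atom
ext-⇉ θ p (suc x) = ren-⇉ suc θ (p x)

subv-⇉ : {σ σ′ : Fin m → Val m′ n′} {θ : Fin n → Fin n′} {E E′ : Exp s m n} →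
         (∀ x → σ x ⇉ σ′ x) → E ⇉ E′ → subv σ θ E ⇉ subv σ′ θ E′
subv-⇉ p (atom {x = x}) = p x
subv-⇉ p (lam d)        = lam (subv-⇉ (ext-⇉ suc p) d)
subv-⇉ p (η {W = W} refl d) = η (subv-ren-comm (λ _ → refl) (λ _ → refl) W) (subv-⇉ p d)
subv-⇉ p (ret d)        = ret (subv-⇉ p d)
subv-⇉ p (app a b d)    = app (subv-⇉ p a) (subv-⇉ p b) (subv-⇉ (ext-⇉ id p) d)
subv-⇉ p (β {J′ = J} {W′ = W} {K′ = K} d w k refl) =
  β (subv-⇉ (ext-⇉ suc p) d) (subv-⇉ p w) (subv-⇉ (ext-⇉ id p) k) (subv-contract J W K)

extkᶜ-⇉ : {κ κ′ : Fin n → Cmd (suc m) n′} → (∀ k → κ k ⇉ κ′ k) → ∀ k → extkᶜ κ k ⇉ extkᶜ κ′ k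
extkᶜ-⇉ q zero    = ret atom
extkᶜ-⇉ q (suc k) = ren-⇉ (lift 1 suc) suc (q k)

sub-⇉ : {σ σ′ : Fin m → Val m′ n′} {κ κ′ : Fin n → Cmd (suc m′) n′} {E E′ : Exp s m n} →
        (∀ x → σ x ⇉ σ′ x) → (∀ k → κ k ⇉ κ′ k) → E ⇉ E′ → sub σ κ E ⇉ sub σ′ κ′ E′
sub-⇉ p q (atom {x = x}) = p x
sub-⇉ p q (lam d)        = lam (sub-⇉ (ext-⇉ suc p) (extkᶜ-⇉ q) d)
sub-⇉ p q (η {W = W} refl d) = η (sub-ren-comm (λ _ → refl) (λ _ → refl) W) (sub-⇉ p q d)
sub-⇉ p q (ret {k = k} d) = subv-⇉ (λ { zero → sub-⇉ p q d ; (suc x) → atom }) (q k)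
sub-⇉ p q (app a b d)    =
  app (sub-⇉ p q a) (sub-⇉ p q b) (sub-⇉ (ext-⇉ id p) (λ k → ren-⇉ (lift 1 suc) id (q k)) d)
sub-⇉ p q (β {J′ = J} {W′ = W} {K′ = K} d w k refl) =
  β (sub-⇉ (ext-⇉ suc p) (extkᶜ-⇉ q) d) (sub-⇉ p q w)
    (sub-⇉ (ext-⇉ id p) (λ l → ren-⇉ (lift 1 suc) id (q l)) k) (sub-contract J W K)

contract-⇉ : {J J′ : Cmd (suc m) (suc n)} {W W′ : Val m n} {K K′ : Cmd (suc m) n} →
             J ⇉ J′ → W ⇉ W′ → K ⇉ K′ → contract J W K ⇉ contract J′ W′ K′
contract-⇉ d w k = sub-⇉ (λ { zero → w ; (suc x) → atom }) (λ { zero → k ; (suc l) → ret atom }) d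

-- Pullbacks of renamings and reflection of parallel steps

Square : {a b c d : ℕ} → (Fin b → Fin d) → (Fin c → Fin d) → (Fin a → Fin b) → (Fin a → Fin c) → Set
Square f g f′ g′ = ∀ x y → f x ≡ g y → ∃[ z ] (x ≡ f′ z × y ≡ g′ z)

lift-Square : ∀ {a b c d} {f : Fin b → Fin d} {g : Fin c → Fin d} {f′ : Fin a → Fin b} {g′ : Fin a → Fin c} →
              Square f g f′ g′ → Square (lift 1 f) (lift 1 g) (lift 1 f′) (lift 1 g′)
lift-Square sq zero    zero    eq = zero , refl , refl
lift-Square sq (suc x) (suc y) eq with sq x y (suc-injective eq)
... | z , refl , refl = suc z , refl , refl

suc-Square : {f : Fin n → Fin n′} → Square (lift 1 f) suc suc f
suc-Square (suc x) y eq = x , refl , sym (suc-injective eq)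

suc-mono-Square : Square (suc {n}) suc id id
suc-mono-Square x y eq = x , refl , sym (suc-injective eq)

atom-injective : ∀ {x y} → _≡_ {A = Val m n} (atom x) (atom y) → x ≡ y
atom-injective refl = refl

lam-injective : {J J′ : Cmd (suc m) (suc n)} → lam J ≡ lam J′ → J ≡ J′
lam-injective refl = refl

ret-injective : ∀ {k k′} {W W′ : Val m n} → ret k W ≡ ret k′ W′ → k ≡ k′ × W ≡ W′
ret-injective refl = refl , refl

app-injective : {A A′ B B′ : Val m n} {K K′ : Cmd (suc m) n} →
                app A B K ≡ app A′ B′ K′ → A ≡ A′ × B ≡ B′ × K ≡ K′
app-injective refl = refl , refl , refl

-- Renaming acts on indices alone, so the squares lift through all constructors. With `suc-Square`
-- this strengthens: an expression that is weakened after `lift 1 f` was weakened before.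
ren-pullback : ∀ {a b}
  {ρ₁ : Fin m → Fin m″} {ρ₂ : Fin m′ → Fin m″} {ρ₁′ : Fin a → Fin m} {ρ₂′ : Fin a → Fin m′}
  {θ₁ : Fin n → Fin n″} {θ₂ : Fin n′ → Fin n″} {θ₁′ : Fin b → Fin n} {θ₂′ : Fin b → Fin n′} →
  Square ρ₁ ρ₂ ρ₁′ ρ₂′ → Square θ₁ θ₂ θ₁′ θ₂′ →
  (E : Exp s m n) (F : Exp s m′ n′) → ren ρ₁ θ₁ E ≡ ren ρ₂ θ₂ F →
  ∃[ G ] (E ≡ ren ρ₁′ θ₁′ G × F ≡ ren ρ₂′ θ₂′ G)
ren-pullback p q (atom x) (atom y) eq with p x y (atom-injective eq)
... | z , refl , refl = atom z , refl , refl
ren-pullback p q (lam J) (lam J′) eq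
  with ren-pullback (lift-Square p) (lift-Square q) J J′ (lam-injective eq)
... | G , refl , refl = lam G , refl , refl
ren-pullback p q (ret k W) (ret k′ W′) eq with ret-injective eq
... | eq₁ , eq₂ with q k k′ eq₁ | ren-pullback p q W W′ eq₂
... | l , refl , refl | G , refl , refl = ret l G , refl , refl
ren-pullback p q (app A B K) (app A′ B′ K′) eq with app-injective eq
... | eq₁ , eq₂ , eq₃
  with ren-pullback p q A A′ eq₁ | ren-pullback p q B B′ eq₂ | ren-pullback (lift-Square p) q K K′ eq₃
... | G , refl , refl | H , refl , refl | I , refl , refl = app G H I , refl , refl

weaken-injective : {E F : Exp s m n} → ren suc suc E ≡ ren suc suc F → E ≡ F
weaken-injective {E = E} {F} eq with ren-pullback suc-mono-Square suc-mono-Square E F eq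
... | G , refl , refl = refl

lift-zero : {f : Fin n → Fin n′} (x : Fin (suc n)) → zero ≡ lift 1 f x → x ≡ zero
lift-zero zero eq = refl

ren-atom-zero : {ρ : Fin m → Fin m′} {θ : Fin n → Fin n′} (W : Val (suc m) n) →
                atom zero ≡ ren (lift 1 ρ) θ W → W ≡ atom zero
ren-atom-zero (atom x) eq = cong atom (lift-zero x (atom-injective eq))

-- Renaming creates no redexes. Only `η` has a freshness condition, and `ren-pullback` carries it
-- back.
ren-reflects-⇉ : {ρ : Fin m → Fin m′} {θ : Fin n → Fin n′} {F F′ : Exp s m′ n′} →
                 F ⇉ F′ → (E : Exp s m n) → F ≡ ren ρ θ E → ∃[ E′ ] (E ⇉ E′ × F′ ≡ ren ρ θ E′)
ren-reflects-⇉ atom (atom x) eq = atom x , atom , eq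
ren-reflects-⇉ (lam d) (lam J) eq with ren-reflects-⇉ d J (lam-injective eq)
... | J′ , d′ , eq′ = lam J′ , lam d′ , cong lam eq′
ren-reflects-⇉ (η {W = W} refl d) (lam (app A B (ret k C))) eq
  with app-injective (lam-injective eq)
... | eqA , eqB , eqK with ret-injective eqK
... | eqk , eqC with lift-zero k eqk | ren-atom-zero B eqB | ren-atom-zero C eqC
                   | ren-pullback suc-Square suc-Square A W (sym eqA)
... | refl | refl | refl | W₀ , refl , refl with ren-reflects-⇉ d W₀ refl
... | W′ , d′ , eq′ = W′ , η refl d′ , eq′
ren-reflects-⇉ (η refl d) (lam (app A B (app _ _ _))) eq with app-injective (lam-injective eq)
... | _ , _ , ()
ren-reflects-⇉ (ret d) (ret k W) eq with ret-injective eq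
... | refl , eqW with ren-reflects-⇉ d W eqW
... | W′ , d′ , eq′ = ret k W′ , ret d′ , cong (ret _) eq′
ren-reflects-⇉ (app a b d) (app A B K) eq with app-injective eq
... | eqA , eqB , eqK
  with ren-reflects-⇉ a A eqA | ren-reflects-⇉ b B eqB | ren-reflects-⇉ d K eqK
... | A′ , a′ , refl | B′ , b′ , refl | K′ , d′ , refl = app A′ B′ K′ , app a′ b′ d′ , refl
ren-reflects-⇉ (β d w k refl) (app (lam J) W K) eq with app-injective eq
... | eqJ , eqW , eqK
  with ren-reflects-⇉ d J (lam-injective eqJ) | ren-reflects-⇉ w W eqW | ren-reflects-⇉ k K eqK
... | J′ , d′ , refl | W′ , w′ , refl | K′ , k′ , refl =
  contract J′ W′ K′ , β d′ w′ k′ refl , sym (ren-contract J′ W′ K′)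
ren-reflects-⇉ (β d w k refl) (app (atom x) W K) eq with app-injective eq
... | () , _

-- An abstraction applied to a variable and a continuation just bound gives its own body. This
-- settles the overlap of β and η in an η-expanded abstraction.
contract-var : {ρ : Fin m → Fin m′} {θ : Fin n → Fin n′} (J : Cmd (suc m) (suc n)) →
  contract (ren (lift 1 (suc ∘ ρ)) (lift 1 (suc ∘ θ)) J) (atom zero) (ret zero (atom zero)) ≡
  ren (lift 1 ρ) (lift 1 θ) J
contract-var {ρ = ρ} {θ} J = trans
  (sub-ren {τ = atom ∘ lift 1 ρ} {κ′ = retk (lift 1 θ)}
           (λ { zero → refl ; (suc x) → refl }) (λ { zero → refl ; (suc k) → refl }) J)
  (sub-as-ren (λ _ → refl) (λ _ → refl) J)

contract-weaken : (J : Cmd (suc m) (suc n)) →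
  contract (ren (lift 1 suc) (lift 1 suc) J) (atom zero) (ret zero (atom zero)) ≡ J
contract-weaken J = trans (contract-var {ρ = id} {θ = id} J) (ren-id (lift-id (λ _ → refl)) (lift-id (λ _ → refl)) J)

-- A function that η-reduces to an abstraction still contracts in one parallel step.
app-β-ren : {A : Val m n} {J : Cmd (suc m) (suc n)} {ρ : Fin m → Fin m′} {θ : Fin n → Fin n′}
            {W W′ : Val m′ n′} {K K′ : Cmd (suc m′) n′} →
            A ⇉ lam J → W ⇉ W′ → K ⇉ K′ →
            app (ren ρ θ A) W K ⇉ contract (ren (lift 1 ρ) (lift 1 θ) J) W′ K′
app-β-ren {ρ = ρ} {θ} (lam d) w k = β (ren-⇉ _ _ d) w k refl
app-β-ren {J = J} {ρ} {θ} (η {W = B} refl d) w k =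
  -- The inner call is contracted by induction under the two binders of the η-redex, hence at
  -- `suc ∘ ρ` and `suc ∘ θ`; this is why the lemma speaks of a renamed function.
  β (subst₂ _⇉_ (cong (λ A → app A (atom zero) (ret zero (atom zero)))
                      (sym (ren-ren (λ _ → refl) (λ _ → refl) B)))
                (contract-var J)
                (app-β-ren d atom (ret atom)))
    w k refl

app-β : {A : Val m n} {J : Cmd (suc m) (suc n)} {W W′ : Val m n} {K K′ : Cmd (suc m) n} →
        A ⇉ lam J → W ⇉ W′ → K ⇉ K′ → app A W K ⇉ contract J W′ K′
app-β {A = A} {J} {W} {W′} {K} {K′} a w k =
  subst₂ _⇉_ (cong (λ A → app A W K) (ren-id (λ _ → refl) (λ _ → refl) A))
             (cong (λ J → contract J W′ K′) (ren-id (lift-id (λ _ → refl)) (lift-id (λ _ → refl)) J))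
             (app-β-ren {ρ = id} {θ = id} a w k)

-- The diamond property

Joinable : Exp s m n → Exp s m n → Set
Joinable E F = ∃[ G ] (E ⇉ G × F ⇉ G)

Joinable-sym : {E F : Exp s m n} → Joinable E F → Joinable F E
Joinable-sym (G , d , e) = G , e , d

weaken-Joinable : {E F : Exp s m n} → Joinable (ren suc suc E) (ren suc suc F) → Joinable E F
weaken-Joinable {E = E} {F} (G , d , e) with ren-reflects-⇉ d E refl | ren-reflects-⇉ e F refl
... | E′ , d′ , refl | F′ , e′ , eq with weaken-injective eq
... | refl = E′ , d′ , e′

weaken-⇉ : {A : Exp s (suc m) (suc n)} {E E′ : Exp s m n} → A ≡ ren suc suc E → E ⇉ E′ → A ⇉ ren suc suc E′
weaken-⇉ refl d = ren-⇉ suc suc d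

mutual
  -- The induction is on the expression, and an η-redex contains the weakened `A`, not the `W` it
  -- comes from. So steps of `W` are weakened and joined at `A`, and `weaken-Joinable` brings the
  -- join back.
  diamond : (E : Exp s m n) {E₁ E₂ : Exp s m n} → E ⇉ E₁ → E ⇉ E₂ → Joinable E₁ E₂
  diamond (atom x) atom atom = _ , atom , atom
  diamond (lam J) (lam d) (lam e) with diamond J d e
  ... | J′ , d′ , e′ = lam J′ , lam d′ , lam e′
  diamond (lam (app A _ _)) (η eq d) (lam e) = diamond-η A eq d e
  diamond (lam (app A _ _)) (lam d) (η eq e) = Joinable-sym (diamond-η A eq e d)
  diamond (lam (app A _ _)) (η eq d) (η eq′ e) with weaken-injective (trans (sym eq) eq′)
  ... | refl = weaken-Joinable (diamond A (weaken-⇉ eq d) (weaken-⇉ eq′ e))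
  diamond (ret k W) (ret d) (ret e) with diamond W d e
  ... | W′ , d′ , e′ = ret k W′ , ret d′ , ret e′
  diamond (app A B K) (app a b d) (app a₁ b₁ d₁) with diamond A a a₁ | diamond B b b₁ | diamond K d d₁
  ... | A′ , a′ , a₁′ | B′ , b′ , b₁′ | K′ , d′ , d₁′ = app A′ B′ K′ , app a′ b′ d′ , app a₁′ b₁′ d₁′
  diamond (app A B K) (app a b d) (β j w k refl) = diamond-β A B K a b d refl j w k
  diamond (app A B K) (β j w k refl) (app a b d) = Joinable-sym (diamond-β A B K a b d refl j w k)
  diamond (app (lam J) W K) (β j w k refl) (β j₁ w₁ k₁ refl)
    with diamond J j j₁ | diamond W w w₁ | diamond K k k₁
  ... | J′ , j′ , j₁′ | W′ , w′ , w₁′ | K′ , k′ , k₁′ =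
    contract J′ W′ K′ , contract-⇉ j′ w′ k′ , contract-⇉ j₁′ w₁′ k₁′

  -- A step that keeps the call leaves an η-redex, because a reduct of a weakened function is
  -- weakened. A step that contracts the call yields, by `contract-weaken`, a body `C₁` such that
  -- `lam C₁` is itself a reduct of `W`.
  diamond-η : (A : Val (suc m) (suc n)) {W W₁ : Val m n} {J : Cmd (suc m) (suc n)} →
              A ≡ ren suc suc W → W ⇉ W₁ → app A (atom zero) (ret zero (atom zero)) ⇉ J →
              Joinable W₁ (lam J)
  diamond-η A {W} eq d (app a atom (ret atom)) with ren-reflects-⇉ a W eq | diamond A (weaken-⇉ eq d) a
  ... | W₂ , _ , refl | join with weaken-Joinable join
  ... | W₃ , e₁ , e₂ = W₃ , e₁ , η refl e₂
  diamond-η A@(lam C) {lam C₀} eq d (β j atom (ret atom) refl)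
    with ren-reflects-⇉ j C₀ (lam-injective eq) | diamond A (weaken-⇉ eq d) (lam j)
  ... | C₁ , _ , refl | join with weaken-Joinable {F = lam C₁} join
  ... | W₃ , e₁ , e₂ = W₃ , e₁ , ≡.subst (λ J → lam J ⇉ W₃) (sym (contract-weaken C₁)) e₂

  diamond-β : (A B : Val m n) (K : Cmd (suc m) n) {A₁ B₁ W₁ : Val m n} {K₁ K₂ : Cmd (suc m) n}
              {J J₁ : Cmd (suc m) (suc n)} →
              A ⇉ A₁ → B ⇉ B₁ → K ⇉ K₁ → A ≡ lam J → J ⇉ J₁ → B ⇉ W₁ → K ⇉ K₂ →
              Joinable (app A₁ B₁ K₁) (contract J₁ W₁ K₂)
  diamond-β A B K a b d refl j w k with diamond A a (lam j) | diamond B b w | diamond K d k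
  ... | lam J′ , a′ , lam j′ | B′ , b′ , w′ | K′ , d′ , k′ =
    contract J′ B′ K′ , app-β a′ b′ d′ , contract-⇉ j′ w′ k′
  -- Here `lam J₁` is the η-expansion of `C`, so its contraction is the call `app C W₁ K₂`, and a
  -- congruence step completes the diamond.
  ... | A′ , a′ , η {W = C} refl c | B′ , b′ , w′ | K′ , d′ , k′ =
    app A′ B′ K′ , app a′ b′ d′ ,
    app (≡.subst (_⇉ A′) (sym (sub-weaken C)) c) w′
        (≡.subst (_⇉ K′) (sym (subv-lift-suc _)) k′)

strip : {E E₁ E₂ : Exp s m n} → E ⇉ E₁ → E ⇉* E₂ → ∃[ E₃ ] (E₁ ⇉* E₃ × E₂ ⇉ E₃)
strip d []       = _ , [] , d
strip d (e ◅ es) with diamond _ d e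
... | _ , d′ , e′ with strip e′ es
... | _ , ds , e″ = _ , d′ ◅ ds , e″

confluence : {E E₁ E₂ : Exp s m n} → E ⇉* E₁ → E ⇉* E₂ → ∃[ E₃ ] (E₁ ⇉* E₃ × E₂ ⇉* E₃)
confluence []       es = _ , es , []
confluence (d ◅ ds) es with strip d es
... | _ , es′ , d′ with confluence ds es′
... | _ , ds′ , es″ = _ , ds′ , d′ ◅ es″

-- Translation into the target

bind : Cmd m (suc n) → Cmd (suc m) (suc n) → Cmd m (suc n)
bind J K = sub atom (K ∷ retk suc) J

call : Val m (suc n) → Val m (suc n) → Cmd m (suc n)
call A B = app A B (ret zero (atom zero))

call₁₀ : Cmd (suc (suc m)) (suc n)
call₁₀ = call (atom (suc zero)) (atom zero)

-- Continuation index zero is where the term returns. `ε` identifies its tag with this index and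
-- `throw` renames it to the tag, so both are mere renamings. A value does not use it, hence the
-- weakening before `ret`.
⟦_⟧ : Term m n → Cmd m (suc n)
⟦ var x ⟧     = ret zero (atom x)
⟦ ƛ M ⟧       = ret zero (ren id suc (lam ⟦ M ⟧))
⟦ M · N ⟧     = bind ⟦ M ⟧ (bind (ren suc id ⟦ N ⟧) call₁₀)
⟦ L Where M ⟧ = bind ⟦ M ⟧ ⟦ L ⟧
⟦ ε M ⟧       = ren id (zero ∷ id) ⟦ M ⟧
⟦ throw k M ⟧ = ren id (suc k ∷ suc) ⟦ M ⟧

-- Translation of renaming and substitution

ren-ext : {ρ ρ′ : Fin m → Fin m′} {θ θ′ : Fin n → Fin n′} →
          (∀ x → ρ x ≡ ρ′ x) → (∀ k → θ k ≡ θ′ k) → (E : Exp s m n) → ren ρ θ E ≡ ren ρ′ θ′ E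
ren-ext {ρ = ρ} {θ = θ} p q E = trans
  (cong (ren ρ θ) (sym (ren-id (λ _ → refl) (λ _ → refl) E))) (ren-ren p q E)

-- `θ′` is only pointwise `lift 1 θ`, so that it can also be `id`.
ren-bind : {ρ : Fin m → Fin m′} {θ : Fin n → Fin n′} {θ′ : Fin (suc n) → Fin (suc n′)} →
           (∀ k → θ′ k ≡ lift 1 θ k) → (J : Cmd m (suc n)) (K : Cmd (suc m) (suc n)) →
           ren ρ θ′ (bind J K) ≡ bind (ren ρ θ′ J) (ren (lift 1 ρ) θ′ K)
ren-bind {ρ = ρ} {θ} {θ′} q J K = sym (sub-ren-comm (λ _ → refl) cont J)
  where
  cont : ∀ k → (ren (lift 1 ρ) θ′ K ∷ retk suc) (θ′ k) ≡ ren (lift 1 ρ) θ′ ((K ∷ retk suc) k)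
  cont zero    rewrite q zero    = refl
  cont (suc k) rewrite q (suc k) = refl

id≗lift-id : ∀ (k : Fin (suc n)) → k ≡ lift 1 id k
id≗lift-id zero    = refl
id≗lift-id (suc k) = refl

⟦rename⟧ : (ρ : Fin m → Fin m′) (M : Term m n) → ⟦ rename ρ M ⟧ ≡ ren ρ id ⟦ M ⟧
⟦rename⟧ ρ (var x) = refl
⟦rename⟧ ρ (ƛ M)   = cong (λ J → ret zero (lam J)) (trans
  (cong (ren (lift 1 id) (lift 1 suc)) (⟦rename⟧ (lift 1 ρ) M))
  (ren-comm (λ { zero → refl ; (suc x) → refl }) (λ { zero → refl ; (suc k) → refl }) ⟦ M ⟧))
⟦rename⟧ ρ (M · N) = trans
  (cong₂ (λ J K → bind J (bind K call₁₀)) (⟦rename⟧ ρ M)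
    (trans (cong (ren suc id) (⟦rename⟧ ρ N)) (ren-comm (λ _ → refl) (λ _ → refl) ⟦ N ⟧)))
  (sym (trans (ren-bind id≗lift-id ⟦ M ⟧ _)
    (cong (bind (ren ρ id ⟦ M ⟧)) (ren-bind id≗lift-id (ren suc id ⟦ N ⟧) call₁₀))))
⟦rename⟧ ρ (L Where M) = trans
  (cong₂ bind (⟦rename⟧ ρ M) (⟦rename⟧ (lift 1 ρ) L))
  (sym (ren-bind id≗lift-id ⟦ M ⟧ ⟦ L ⟧))
⟦rename⟧ ρ (ε M) = trans (cong (ren id (zero ∷ id)) (⟦rename⟧ ρ M))
                         (ren-comm (λ _ → refl) (λ _ → refl) ⟦ M ⟧)
⟦rename⟧ ρ (throw k M) = trans (cong (ren id (suc k ∷ suc)) (⟦rename⟧ ρ M))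
                               (ren-comm (λ _ → refl) (λ _ → refl) ⟦ M ⟧)

⟦renameᶜ⟧ : (θ : Fin n → Fin n′) (M : Term m n) → ⟦ renameᶜ θ M ⟧ ≡ ren id (lift 1 θ) ⟦ M ⟧
⟦renameᶜ⟧ θ (var x) = refl
⟦renameᶜ⟧ θ (ƛ M)   = cong (λ J → ret zero (lam J)) (trans
  (cong (ren (lift 1 id) (lift 1 suc)) (⟦renameᶜ⟧ θ M))
  (ren-comm (λ { zero → refl ; (suc x) → refl }) (λ { zero → refl ; (suc k) → refl }) ⟦ M ⟧))
⟦renameᶜ⟧ θ (M · N) = trans
  (cong₂ (λ J K → bind J (bind K call₁₀)) (⟦renameᶜ⟧ θ M)
    (trans (cong (ren suc id) (⟦renameᶜ⟧ θ N)) (ren-comm {ρ₄ = lift 1 id} (λ _ → refl) (λ _ → refl) ⟦ N ⟧)))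
  (sym (trans (ren-bind (λ _ → refl) ⟦ M ⟧ _)
    (cong (bind (ren id (lift 1 θ) ⟦ M ⟧)) (ren-bind (λ _ → refl) (ren suc id ⟦ N ⟧) call₁₀))))
⟦renameᶜ⟧ θ (L Where M) = trans
  (cong₂ bind (⟦renameᶜ⟧ θ M) (trans (⟦renameᶜ⟧ θ L) (ren-ext id≗lift-id (λ _ → refl) ⟦ L ⟧)))
  (sym (ren-bind (λ _ → refl) ⟦ M ⟧ ⟦ L ⟧))
⟦renameᶜ⟧ θ (ε M) = trans (cong (ren id (zero ∷ id)) (⟦renameᶜ⟧ (lift 1 θ) M))
  (ren-comm (λ _ → refl) (λ { zero → refl ; (suc zero) → refl ; (suc (suc k)) → refl }) ⟦ M ⟧)
⟦renameᶜ⟧ θ (throw k M) = trans (cong (ren id (suc (θ k) ∷ suc)) (⟦renameᶜ⟧ θ M))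
  (ren-comm (λ _ → refl) (λ { zero → refl ; (suc l) → refl }) ⟦ M ⟧)

ren-retract : {θ : Fin n → Fin n′} {θ′ : Fin n′ → Fin n} → (∀ k → θ′ (θ k) ≡ k) →
              (E : Exp s m n) → ren id θ′ (ren id θ E) ≡ E
ren-retract q E = trans (ren-ren (λ _ → refl) q E) (ren-id (λ _ → refl) (λ _ → refl) E)

bind-weaken : (K : Cmd (suc m) (suc n)) (E : Exp s m n) → sub atom (K ∷ retk suc) (ren id suc E) ≡ ren id suc E
bind-weaken K E = trans (sub-ren (λ _ → refl) (λ _ → refl) E) (sub-as-ren (λ _ → refl) (λ _ → refl) E)

bind-ret : (W : Val m n) (K : Cmd (suc m) (suc n)) →
           bind (ret zero (ren id suc W)) K ≡ subv (ren id suc W ∷ atom) id K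
bind-ret W K = cong (λ V → subv (V ∷ atom) id K) (bind-weaken K W)

-- The substituted values must not mention the return continuation, since `bind` would replace it in
-- them; hence their form `ren id suc (W x)`.
subv-bind : {τ : Fin m → Val m′ (suc n)} (W : Fin m → Val m′ n) → (∀ x → τ x ≡ ren id suc (W x)) →
            (J : Cmd m (suc n)) (K : Cmd (suc m) (suc n)) →
            subv τ id (bind J K) ≡ bind (subv τ id J) (subv (extv τ) id K)
subv-bind {τ = τ} W p J K = trans
  (subv-sub {σ′ = τ} {κ′ = subv (extv τ) id K ∷ retk suc} (λ _ → refl) (λ { zero → refl ; (suc k) → refl }) J)
  (sym (sub-subv (λ x → trans (cong (sub atom _) (p x)) (trans (bind-weaken _ (W x)) (sym (p x)))) (λ _ → refl) J))

⟦subst⟧ : (σ : Fin m → Term m′ n) (W : Fin m → Val m′ n) →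
          (∀ x → ⟦ σ x ⟧ ≡ ret zero (ren id suc (W x))) →
          (M : Term m n) → ⟦ subst σ M ⟧ ≡ subv (ren id suc ∘ W) id ⟦ M ⟧

⟦subst⟧-ext : (σ : Fin m → Term m′ n) (W : Fin m → Val m′ n) →
              (∀ x → ⟦ σ x ⟧ ≡ ret zero (ren id suc (W x))) →
              (M : Term (suc m) n) → ⟦ subst (var zero ∷ (weaken ∘ σ)) M ⟧ ≡ subv (extv (ren id suc ∘ W)) id ⟦ M ⟧

⟦subst⟧ σ W p (var x) = p x
⟦subst⟧ σ W p (ƛ M)   = cong (λ J → ret zero (lam J)) (trans
  (cong (ren (lift 1 id) (lift 1 suc)) (⟦subst⟧-ext σ W p M))
  (sym (subv-ren-comm
    (λ { zero → refl
       ; (suc x) → trans (ren-ren (λ _ → refl) (λ _ → refl) (W x))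
           (sym (trans (cong (ren (lift 1 id) (lift 1 suc)) (ren-ren (λ _ → refl) (λ _ → refl) (W x)))
                       (ren-ren (λ _ → refl) (λ _ → refl) (W x)))) })
    (λ { zero → refl ; (suc k) → refl }) ⟦ M ⟧)))
⟦subst⟧ σ W p (M · N) = trans
  (cong₂ (λ J K → bind J (bind K call₁₀)) (⟦subst⟧ σ W p M)
    (trans (cong (ren suc id) (⟦subst⟧ σ W p N))
           (sym (subv-ren-comm (λ _ → refl) (λ _ → refl) ⟦ N ⟧))))
  (sym (trans (subv-bind W (λ _ → refl) ⟦ M ⟧ _)
    (cong (bind (subv (ren id suc ∘ W) id ⟦ M ⟧)) (subv-bind (extv W)
      (λ { zero → refl ; (suc x) → ren-comm (λ _ → refl) (λ _ → refl) (W x) }) (ren suc id ⟦ N ⟧) call₁₀))))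
⟦subst⟧ σ W p (L Where M) = trans
  (cong₂ bind (⟦subst⟧ σ W p M) (⟦subst⟧-ext σ W p L))
  (sym (subv-bind W (λ _ → refl) ⟦ M ⟧ ⟦ L ⟧))
⟦subst⟧ σ W p (ε M) = trans
  (cong (ren id (zero ∷ id)) (⟦subst⟧ (weakenᶜ ∘ σ) (ren id suc ∘ W)
    (λ x → trans (⟦renameᶜ⟧ suc (σ x)) (trans (cong (ren id (lift 1 suc)) (p x))
      (cong (ret zero) (ren-comm (λ _ → refl) (λ _ → refl) (W x))))) M))
  (sym (subv-ren-comm (λ x → sym (ren-retract (λ _ → refl) (ren id suc (W x)))) (λ _ → refl) ⟦ M ⟧))
⟦subst⟧ σ W p (throw k M) = trans
  (cong (ren id (suc k ∷ suc)) (⟦subst⟧ σ W p M))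
  (sym (subv-ren-comm (λ x → sym (ren-ren (λ _ → refl) (λ _ → refl) (W x))) (λ _ → refl) ⟦ M ⟧))

⟦subst⟧-ext σ W p M = trans
  (⟦subst⟧ (var zero ∷ (weaken ∘ σ)) (extv W)
    (λ { zero → refl
       ; (suc x) → trans (⟦rename⟧ suc (σ x)) (trans (cong (ren suc id) (p x))
           (cong (ret zero) (ren-comm (λ _ → refl) (λ _ → refl) (W x)))) }) M)
  (subv-ext (λ { zero → refl ; (suc x) → ren-comm (λ _ → refl) (λ _ → refl) (W x) }) ⟦ M ⟧)

-- Translation of the replacement of throws

redirect : Fin n → Cmd (suc m) n → Fin n → Cmd (suc m) n
redirect k J j = if does (j ≟ k) then J else ret j (atom zero)

under : (Fin n → Cmd (suc m) n) → Fin (suc n) → Cmd (suc m) (suc n)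
under κ = ret zero (atom zero) ∷ (ren id suc ∘ κ)

weaken-let : {K : Cmd (suc m) (suc n)} (J : Cmd (suc m) n) →
             sub (extv atom) (extk (K ∷ retk suc)) (ren id suc J) ≡ ren id suc J
weaken-let J = trans (sub-ren {τ = atom} (λ { zero → refl ; (suc x) → refl }) (λ _ → refl) J)
                     (sub-as-ren (λ _ → refl) (λ _ → refl) J)

sub-ext : {σ τ : Fin m → Val m′ n′} {κ κ′ : Fin n → Cmd (suc m′) n′} →
          (∀ x → σ x ≡ τ x) → (∀ k → κ k ≡ κ′ k) → (E : Exp s m n) → sub σ κ E ≡ sub τ κ′ E
sub-ext {σ = σ} {κ = κ} p q E = trans
  (cong (sub σ κ) (sym (ren-id (λ _ → refl) (λ _ → refl) E))) (sub-ren p q E)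

sub-bind : (κ : Fin n → Cmd (suc m) n) (J : Cmd m (suc n)) (K : Cmd (suc m) (suc n)) →
           sub atom (under κ) (bind J K) ≡ bind (sub atom (under κ) J) (sub (extv atom) (extk (under κ)) K)
sub-bind κ J K = trans
  (sub-sub {σ₃ = atom} {κ₃ = sub (extv atom) (extk (under κ)) K ∷ (ren id suc ∘ κ)} (λ _ → refl)
           (λ { zero → refl ; (suc l) → subv-lift-suc (ren id suc (κ l)) }) J)
  (sym (sub-sub (λ _ → refl)
           (λ { zero → subv-lift-suc (sub (extv atom) (extk (under κ)) K) ; (suc l) → weaken-let (κ l) }) J))

answer : Fin n → Term (suc m) n → Fin n → Cmd (suc m) n
answer k M = redirect k (ren id (k ∷ id) ⟦ M ⟧)

answer-rename : (k : Fin n) (M : Term (suc m) n) → ∀ j →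
                answer k (rename (lift 1 suc) M) j ≡ ren (lift 1 suc) id (answer k M j)
answer-rename k M j with does (j ≟ k)
... | true  = trans (cong (ren id (k ∷ id)) (⟦rename⟧ (lift 1 suc) M))
                    (ren-comm (λ _ → refl) (λ _ → refl) ⟦ M ⟧)
... | false = refl

answer-renameᶜ : (k : Fin n) (M : Term (suc m) n) → ∀ j →
                 answer (suc k) (weakenᶜ M) (suc j) ≡ ren id suc (answer k M j)
answer-renameᶜ k M j with does (j ≟ k)
... | true  = trans (cong (ren id (suc k ∷ id)) (⟦renameᶜ⟧ suc M))
                    (ren-comm (λ _ → refl) (λ { zero → refl ; (suc l) → refl }) ⟦ M ⟧)
... | false = refl

answer-ext : (k : Fin n) (M : Term (suc m) n) (J : Cmd (suc m) (suc n)) →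
             sub atom (under (answer k (rename (lift 1 suc) M))) J ≡
             sub (extv atom) (extk (under (answer k M))) J
answer-ext k M J = sub-ext
  (λ { zero → refl ; (suc x) → refl })
  (λ { zero → refl
     ; (suc j) → trans (cong (ren id suc) (answer-rename k M j)) (ren-comm (λ _ → refl) (λ _ → refl) (answer k M j)) }) J

-- Wrapping everything thrown to `k` in a `where` with body `M` is, in the target, a substitution
-- for the continuation `k`: what it receives now passes through `⟦ M ⟧`, whose result goes to `k`.
-- Throws inside the inserted `M` stay as they are, just as substitution does not enter what it
-- inserts.
⟦throw-↦⟧ : (N : Term m n) (k : Fin n) (M : Term (suc m) n) →
            ⟦ N ⟨throw k ↦ M ⟩ ⟧ ≡ sub atom (under (answer k M)) ⟦ N ⟧
⟦throw-↦⟧ (var x) k M = refl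
⟦throw-↦⟧ (ƛ N) k M = cong (λ J → ret zero (lam J)) (trans
  (cong (ren (lift 1 id) (lift 1 suc)) (⟦throw-↦⟧ N k (rename (lift 1 suc) M)))
  (sym (sub-ren-comm
    (λ { zero → refl ; (suc x) → refl })
    (λ { zero → refl
       ; (suc j) → sym (trans (cong (ren _ _ ∘ ren id suc) (answer-rename k M j))
           (trans (cong (ren _ _) (ren-ren (λ _ → refl) (λ _ → refl) (answer k M j)))
           (trans (ren-ren (λ { zero → refl ; (suc x) → refl }) (λ _ → refl) (answer k M j))
                  (sym (ren-ren (λ _ → refl) (λ _ → refl) (answer k M j)))))) })
    ⟦ N ⟧)))
⟦throw-↦⟧ (N · P) k M = trans
  (cong₂ (λ J K → bind J (bind K call₁₀)) (⟦throw-↦⟧ N k M)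
    (trans (cong (ren suc id) (⟦throw-↦⟧ P k M))
      (trans (sym (sub-ren-comm (λ _ → refl)
                (λ { zero → refl
                   ; (suc j) → trans (cong (ren id suc) (answer-rename k M j))
                                 (ren-comm (λ _ → refl) (λ _ → refl) (answer k M j)) }) ⟦ P ⟧))
             (answer-ext k M (ren suc id ⟦ P ⟧)))))
  (sym (trans (sub-bind (answer k M) ⟦ N ⟧ _)
    (cong (bind (sub atom (under (answer k M)) ⟦ N ⟧)) (trans (sym (answer-ext k M (bind (ren suc id ⟦ P ⟧) call₁₀)))
      (trans (sub-bind (answer k (rename (lift 1 suc) M)) (ren suc id ⟦ P ⟧) call₁₀)
             (cong (λ J → bind J call₁₀) (answer-ext k M (ren suc id ⟦ P ⟧))))))))
⟦throw-↦⟧ (N Where P) k M = trans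
  (cong₂ bind (⟦throw-↦⟧ P k M) (trans (⟦throw-↦⟧ N k (rename (lift 1 suc) M)) (answer-ext k M ⟦ N ⟧)))
  (sym (sub-bind (answer k M) ⟦ P ⟧ ⟦ N ⟧))
⟦throw-↦⟧ (ε N) k M = trans
  (cong (ren id (zero ∷ id)) (⟦throw-↦⟧ N (suc k) (weakenᶜ M)))
  (sym (sub-ren-comm (λ _ → refl)
    (λ { zero → refl
       ; (suc zero) → refl
       ; (suc (suc j)) → sym (trans (cong (ren _ _ ∘ ren id suc) (answer-renameᶜ k M j))
            (trans (cong (ren _ _) (ren-ren (λ _ → refl) (λ _ → refl) (answer k M j)))
                   (ren-ren (λ { zero → refl ; (suc x) → refl }) (λ _ → refl) (answer k M j)))) })
    ⟦ N ⟧))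
⟦throw-↦⟧ (throw j Q) k M with j ≟ k in eq
-- Both sides are one substitution in `⟦ Q ⟧` whose return continuation is `⟦ M ⟧` redirected to
-- `j`: on the left by fusing `bind` with the substitution, on the right by looking up `j`.
... | yes refl = trans (cong (λ J → ren id (suc j ∷ suc) (bind J ⟦ M ⟧)) (⟦throw-↦⟧ Q j M))
  (trans (ren-sub {τ = atom} {κ′ = ren id (suc j ∷ suc) ⟦ M ⟧ ∷ retk suc} (λ _ → refl)
            (λ { zero → ren-ext (λ { zero → refl ; (suc x) → refl }) (λ _ → refl) ⟦ M ⟧ ; (suc l) → refl })
            (sub atom (under (answer j M)) ⟦ Q ⟧))
  (trans (sub-sub {σ₃ = atom} {κ₃ = ren id (suc j ∷ suc) ⟦ M ⟧ ∷ (ren id suc ∘ answer j M)} (λ _ → refl)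
            (λ { zero → subv-lift-suc (ren id (suc j ∷ suc) ⟦ M ⟧) ; (suc l) → weaken-let (answer j M l) }) ⟦ Q ⟧)
         (sym (sub-ren (λ _ → refl) (λ { zero → hit ; (suc l) → refl }) ⟦ Q ⟧))))
  where
  hit : ren id suc (answer j M j) ≡ ren id (suc j ∷ suc) ⟦ M ⟧
  hit rewrite eq = ren-ren (λ _ → refl) (λ { zero → refl ; (suc l) → refl }) ⟦ M ⟧
... | no _ = trans (cong (ren id (suc j ∷ suc)) (⟦throw-↦⟧ Q k M))
  (sym (sub-ren-comm (λ _ → refl)
    (λ { zero → miss
       ; (suc l) → sym (ren-ren (λ { zero → refl ; (suc x) → refl }) (λ _ → refl) (answer k M l)) }) ⟦ Q ⟧))
  where
  miss : ren id suc (answer k M j) ≡ ret (suc j) (atom zero)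
  miss rewrite eq = refl

-- Translation of values, rules and the generated congruence

valueOf : {V : Term m n} → Value V → Val m n
valueOf (var x) = atom x
valueOf (ƛ M)   = lam ⟦ M ⟧

⟦value⟧ : {V : Term m n} (v : Value V) → ⟦ V ⟧ ≡ ret zero (ren id suc (valueOf v))
⟦value⟧ (var x) = refl
⟦value⟧ (ƛ M)   = refl

⟦where-value⟧ : (M : Term (suc m) n) {V : Term m n} (v : Value V) →
                ⟦ M Where V ⟧ ≡ subv (ren id suc (valueOf v) ∷ atom) id ⟦ M ⟧
⟦where-value⟧ M v = trans (cong (λ J → bind J ⟦ M ⟧) (⟦value⟧ v)) (bind-ret (valueOf v) ⟦ M ⟧)

-- A value returns at once, so only the evaluation of the argument remains.
⟦value-app⟧ : {V : Term m n} (v : Value V) (N : Term m n) →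
              ⟦ V · N ⟧ ≡ bind ⟦ N ⟧ (call (ren suc id (ren id suc (valueOf v))) (atom zero))
⟦value-app⟧ v N = trans (cong (λ J → bind J _) (⟦value⟧ v))
  (trans (bind-ret (valueOf v) (bind (ren suc id ⟦ N ⟧) call₁₀))
  (trans (subv-bind (valueOf v ∷ atom) (λ { zero → refl ; (suc x) → refl }) (ren suc id ⟦ N ⟧) call₁₀)
         (cong (λ J → bind J _) (subv-weaken ⟦ N ⟧))))

⟦value-value⟧ : {V U : Term m n} (v : Value V) (u : Value U) →
                ⟦ V · U ⟧ ≡ call (ren id suc (valueOf v)) (ren id suc (valueOf u))
⟦value-value⟧ {U = U} v u = trans (⟦value-app⟧ v U) (trans
  (trans (cong (λ J → bind J _) (⟦value⟧ u))
    (bind-ret (valueOf u) (call (ren suc id (ren id suc (valueOf v))) (atom zero))))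
  (cong (λ A → call A _) (subv-weaken (ren id suc (valueOf v)))))

weaken-value : {V : Term m n} → Value V → Value (weaken V)
weaken-value (var x) = var (suc x)
weaken-value (ƛ M)   = ƛ rename (lift 1 suc) M

valueOf-weaken : {V : Term m n} (v : Value V) →
                 ren id suc (valueOf (weaken-value v)) ≡ ren suc id (ren id suc (valueOf v))
valueOf-weaken (var x) = refl
valueOf-weaken (ƛ M)   = cong lam (trans (cong (ren (lift 1 id) (lift 1 suc)) (⟦rename⟧ (lift 1 suc) M))
  (ren-comm (λ { zero → refl ; (suc x) → refl }) (λ { zero → refl ; (suc k) → refl }) ⟦ M ⟧))

⟦weaken-value·var⟧ : {V : Term m n} (v : Value V) →
                     ⟦ weaken V · var zero ⟧ ≡ call (ren suc id (ren id suc (valueOf v))) (atom zero)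
⟦weaken-value·var⟧ v = trans (⟦value-value⟧ (weaken-value v) (var zero)) (cong (λ A → call A _) (valueOf-weaken v))

infix 4 _⇊_
_⇊_ : Exp s m n → Exp s m n → Set
E ⇊ F = ∃[ G ] (E ⇉* G × F ⇉* G)

≡⇒⇊ : {E F : Exp s m n} → E ≡ F → E ⇊ F
≡⇒⇊ refl = _ , [] , []

⇊-sym : {E F : Exp s m n} → E ⇊ F → F ⇊ E
⇊-sym (G , p , q) = G , q , p

-- Confluence enters here, and lets `≈` be translated directly into joinability.
⇊-trans : {E F G : Exp s m n} → E ⇊ F → F ⇊ G → E ⇊ G
⇊-trans (_ , p , q) (_ , r , t) with confluence q r
... | _ , q′ , r′ = _ , p ◅◅ q′ , t ◅◅ r′

⇊-map : ∀ {s′ m′ n′} (f : Exp s m n → Exp s′ m′ n′) → (∀ {E F} → E ⇉ F → f E ⇉ f F) →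
        ∀ {E F} → E ⇊ F → f E ⇊ f F
⇊-map f mono (_ , p , q) = _ , gmap f mono p , gmap f mono q

bind-⇊ : {J J′ : Cmd m (suc n)} {K K′ : Cmd (suc m) (suc n)} → J ⇊ J′ → K ⇊ K′ → bind J K ⇊ bind J′ K′
bind-⇊ {J′ = J′} {K} p q = ⇊-trans
  (⇊-map (λ J → bind J K) (sub-⇉ (λ _ → atom) (λ k → ⇉-refl ((K ∷ retk suc) k))) p)
  (⇊-map (bind J′) (λ d → sub-⇉ (λ _ → atom) (λ { zero → d ; (suc k) → ret atom }) (⇉-refl J′)) q)

⟦structural⟧ : {M N : Term m n} → Structural M N → ⟦ M ⟧ ≡ ⟦ N ⟧
⟦structural⟧ (where-where L M N) = trans
  (sub-sub {σ₃ = atom} {κ₃ = bind ⟦ M ⟧ (ren (lift 1 suc) id ⟦ L ⟧) ∷ retk suc} (λ _ → refl)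
    (λ { zero → sub-ext (λ { zero → refl ; (suc x) → refl }) (λ { zero → refl ; (suc k) → refl }) ⟦ M ⟧
       ; (suc k) → refl }) ⟦ N ⟧)
  (cong (λ J → bind ⟦ N ⟧ (bind ⟦ M ⟧ J)) (sym (⟦rename⟧ (lift 1 suc) L)))
⟦structural⟧ (ε-where M N) = sym (trans
  (cong (λ J → ren id (zero ∷ id) (bind J ⟦ M ⟧)) (⟦renameᶜ⟧ suc N))
  (trans (cong (ren id (zero ∷ id)) (sub-ren (λ _ → refl) (λ _ → refl) ⟦ N ⟧))
  (ren-sub (λ _ → refl)
    (λ { zero → ren-ext (λ { zero → refl ; (suc x) → refl }) (λ _ → refl) ⟦ M ⟧ ; (suc k) → refl }) ⟦ N ⟧)))
⟦structural⟧ (throw-where k M N) = sym (ren-sub (λ _ → refl)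
    (λ { zero → ren-ext (λ { zero → refl ; (suc x) → refl }) (λ _ → refl) ⟦ M ⟧ ; (suc k) → refl }) ⟦ N ⟧)

⟦rule⟧ : {M N : Term m n} → Rule M N → ⟦ M ⟧ ⇊ ⟦ N ⟧
⟦rule⟧ (nonvalue-app {N} M _) = ≡⇒⇊ (cong (bind ⟦ N ⟧)
  (sym (trans (⟦value-app⟧ (var zero) (weaken M)) (cong (λ J → bind J _) (⟦rename⟧ suc M)))))
⟦rule⟧ (value-app {N = N} v _) = ≡⇒⇊ (trans (⟦value-app⟧ v N)
  (cong (bind ⟦ N ⟧) (sym (⟦weaken-value·var⟧ v))))
-- The let-body of a `call` is the identity, so the contraction substitutes the value and otherwise
-- only renames.
⟦rule⟧ (β M v) = ⇊-trans (≡⇒⇊ (⟦value-value⟧ (ƛ M) v)) (_ , β (⇉-refl _) (⇉-refl _) (⇉-refl _) refl ◅ [] ,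
  ≡.subst (_ ⇉*_) (trans (⟦where-value⟧ M v) (sym (trans
    (sub-ren {τ = ren id suc (valueOf v) ∷ atom} {κ′ = retk id}
             (λ { zero → refl ; (suc x) → refl }) (λ { zero → refl ; (suc k) → refl }) ⟦ M ⟧)
    (sub-retk (λ _ → refl) (λ _ → refl) ⟦ M ⟧)))) [])
⟦rule⟧ (where-value M {V} v) = ≡⇒⇊ (trans (⟦where-value⟧ M v) (sym (trans
  (⟦subst⟧ (V ∷ var) (valueOf v ∷ atom) (λ { zero → ⟦value⟧ v ; (suc x) → refl }) M)
  (subv-ext (λ { zero → refl ; (suc x) → refl }) ⟦ M ⟧))))
⟦rule⟧ (η {V} v) = ⇊-trans
  (≡⇒⇊ (cong (λ J → ret zero (ren id suc (lam J))) (⟦weaken-value·var⟧ v)))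
  (_ , ret (η (trans (cong (ren (lift 1 id) (lift 1 suc)) (ren-ren (λ _ → refl) (λ _ → refl) (valueOf v)))
                (ren-comm (λ _ → refl) (λ _ → refl) (valueOf v))) (⇉-refl (ren id suc (valueOf v)))) ◅ [] ,
   ≡.subst (⟦ V ⟧ ⇉*_) (⟦value⟧ v) [])
⟦rule⟧ (where-id M) = ≡⇒⇊ (sub-id (λ _ → refl) (λ { zero → refl ; (suc k) → refl }) ⟦ M ⟧)
⟦rule⟧ (ε-unused M) = ≡⇒⇊ (trans (cong (ren id (zero ∷ id)) (⟦renameᶜ⟧ suc M))
  (ren-retract (λ { zero → refl ; (suc k) → refl }) ⟦ M ⟧))
⟦rule⟧ (ε-throw M) = ≡⇒⇊ (ren-ren (λ _ → refl) (λ { zero → refl ; (suc k) → refl }) ⟦ M ⟧)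
⟦rule⟧ (where-throw M k N) = ≡⇒⇊ (trans (sub-ren (λ _ → refl) (λ { zero → refl ; (suc l) → refl }) ⟦ N ⟧)
  (sub-as-ren {κ = retk (suc k ∷ suc)} (λ _ → refl) (λ _ → refl) ⟦ N ⟧))
⟦rule⟧ (throw-throw l k N) = ≡⇒⇊ (ren-ren (λ _ → refl) (λ { zero → refl ; (suc _) → refl }) ⟦ N ⟧)
-- Both sides put `⟦ M ⟧` in `⟦ N ⟧` for two continuations, the return of `N` and the tag of the
-- block. On the left `ε` has identified them; on the right the `where` accounts for the first and
-- the replacement of throws for the second.
⟦rule⟧ (where-ε M N) = ≡⇒⇊ (sym (trans
  (cong (ren id (zero ∷ id)) (trans
    (cong₂ bind (⟦throw-↦⟧ N zero (weakenᶜ M)) (⟦renameᶜ⟧ suc M))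
    (sub-sub {σ₃ = atom} {κ₃ = κ} (λ _ → refl)
      (λ { zero → subv-lift-suc (ren id (lift 1 suc) ⟦ M ⟧)
         ; (suc zero) → weaken-let (answer zero (weakenᶜ M) zero)
         ; (suc (suc k)) → refl }) ⟦ N ⟧)))
  (trans (ren-sub {κ′ = ⟦ M ⟧ ∷ (⟦ M ⟧ ∷ retk suc)} (λ _ → refl)
    (λ { zero → trans (ren-ext (λ { zero → refl ; (suc x) → refl }) (λ _ → refl) (ren id (lift 1 suc) ⟦ M ⟧))
                  (ren-retract (λ { zero → refl ; (suc k) → refl }) ⟦ M ⟧)
       ; (suc zero) → trans (cong (λ J → ren (lift 1 id) (zero ∷ id) (ren id suc (ren id (zero ∷ id) J))) (⟦renameᶜ⟧ suc M))
           (trans (cong (λ J → ren (lift 1 id) (zero ∷ id) (ren id suc J)) (ren-retract (λ { zero → refl ; (suc k) → refl }) ⟦ M ⟧))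
             (trans (ren-ext (λ { zero → refl ; (suc x) → refl }) (λ _ → refl) (ren id suc ⟦ M ⟧))
               (ren-retract (λ _ → refl) ⟦ M ⟧)))
       ; (suc (suc k)) → refl }) ⟦ N ⟧)
    (sym (sub-ren (λ _ → refl) (λ { zero → refl ; (suc zero) → refl ; (suc (suc k)) → refl }) ⟦ N ⟧)))))
  where
  κ : Fin (suc (suc _)) → Cmd _ _
  κ = ren id (lift 1 suc) ⟦ M ⟧ ∷ (ren id suc (answer zero (weakenᶜ M) zero) ∷ retk (λ k → suc (suc k)))
⟦rule⟧ (throw-ε l M) = ≡⇒⇊ (trans (ren-comm (λ _ → refl)
    (λ { zero → refl ; (suc zero) → refl ; (suc (suc k)) → refl }) ⟦ M ⟧)
  (cong (ren id (suc l ∷ suc)) (sym (⟦renameᶜ⟧ (l ∷ id) M))))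
⟦rule⟧ (ε-ε M) = ≡⇒⇊ (trans (ren-comm (λ _ → refl)
    (λ { zero → refl ; (suc zero) → refl ; (suc (suc k)) → refl }) ⟦ M ⟧)
  (cong (ren id (zero ∷ id)) (sym (⟦renameᶜ⟧ (zero ∷ id) M))))

⟦≈⟧ : {M N : Term m n} → M ≈ N → ⟦ M ⟧ ⇊ ⟦ N ⟧
⟦≈⟧ (base (inj₁ r))     = ≡⇒⇊ (⟦structural⟧ r)
⟦≈⟧ (base (inj₂ r))     = ⟦rule⟧ r
⟦≈⟧ refl                = ≡⇒⇊ refl
⟦≈⟧ (Congruence.sym p)  = ⇊-sym (⟦≈⟧ p)
⟦≈⟧ (Congruence.trans p q) = ⇊-trans (⟦≈⟧ p) (⟦≈⟧ q)
⟦≈⟧ (ƛ p)               = ⇊-map (λ J → ret zero (ren id suc (lam J))) (λ d → ret (ren-⇉ id suc (lam d))) (⟦≈⟧ p)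
⟦≈⟧ (p · q)             = bind-⇊ (⟦≈⟧ p) (bind-⇊ (⇊-map (ren suc id) (ren-⇉ suc id) (⟦≈⟧ q)) (≡⇒⇊ refl))
⟦≈⟧ (p Where q)         = bind-⇊ (⟦≈⟧ q) (⟦≈⟧ p)
⟦≈⟧ (ε p)               = ⇊-map _ (ren-⇉ id (zero ∷ id)) (⟦≈⟧ p)
⟦≈⟧ (throw {k = k} p)   = ⇊-map _ (ren-⇉ id (suc k ∷ suc)) (⟦≈⟧ p)

-- Reduction of source terms and continuation renaming

⟶*-trans : {M N P : Term m n} → M ⟶* N → N ⟶* P → M ⟶* P
⟶*-trans (done p) (done q) = done (Congruence.trans p q)
⟶*-trans (done p) (step (_ , _ , q , r , t) rs) = step (_ , _ , Congruence.trans p q , r , t) rs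
⟶*-trans (step r rs) ts = step r (⟶*-trans rs ts)

≡⇒⟶* : {M N : Term m n} → M ≡ N → M ⟶* N
≡⇒⟶* refl = done refl

structural : {M N : Term m n} → Structural M N → M ⟶* N
structural r = done (base r)

rule : {M N : Term m n} → Rule M N → M ⟶* N
rule r = step (_ , _ , refl , base r , refl) (done refl)

⟶*-map : (f : Term m n → Term m′ n′) → (∀ {M N} → M ≅ N → f M ≅ f N) →
         (∀ {M N} → Compatible Rule M N → Compatible Rule (f M) (f N)) →
         ∀ {M N} → M ⟶* N → f M ⟶* f N
⟶*-map f cg cp (done p) = done (cg p)
⟶*-map f cg cp (step (_ , _ , p , r , q) rs) = step (_ , _ , cg p , cp r , cg q) (⟶*-map f cg cp rs)

ƛ-⟶* : {M N : Term (suc m) n} → M ⟶* N → ƛ M ⟶* ƛ N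
ƛ-⟶* = ⟶*-map ƛ_ ƛ_ ƛ_

·-⟶* : {M M′ N N′ : Term m n} → M ⟶* M′ → N ⟶* N′ → M · N ⟶* M′ · N′
·-⟶* {M′ = M′} {N} p q =
  ⟶*-trans (⟶*-map (_· N) (_· refl) ·ˡ p) (⟶*-map (M′ ·_) (refl ·_) ·ʳ q)

Where-⟶* : {L L′ : Term (suc m) n} {M M′ : Term m n} → L ⟶* L′ → M ⟶* M′ → L Where M ⟶* L′ Where M′
Where-⟶* {L′ = L′} {M} p q =
  ⟶*-trans (⟶*-map (_Where M) (_Where refl) Whereˡ p) (⟶*-map (L′ Where_) (refl Where_) Whereʳ q)

ε-⟶* : {M N : Term m (suc n)} → M ⟶* N → ε M ⟶* ε N
ε-⟶* = ⟶*-map ε_ ε_ ε_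

throw-⟶* : {k : Fin n} {M N : Term m n} → M ⟶* N → throw k M ⟶* throw k N
throw-⟶* = ⟶*-map (throw _) throw throw

-- Laws of continuation renaming in source terms

renameᶜ-id : {θ : Fin n → Fin n} → (∀ k → θ k ≡ k) → (M : Term m n) → renameᶜ θ M ≡ M
renameᶜ-id q (var x)     = refl
renameᶜ-id q (ƛ M)       = cong ƛ_ (renameᶜ-id q M)
renameᶜ-id q (M · N)     = cong₂ _·_ (renameᶜ-id q M) (renameᶜ-id q N)
renameᶜ-id q (L Where M) = cong₂ _Where_ (renameᶜ-id q L) (renameᶜ-id q M)
renameᶜ-id q (ε M)       = cong ε_ (renameᶜ-id (lift-id q) M)
renameᶜ-id q (throw k M) = cong₂ throw (q k) (renameᶜ-id q M)

renameᶜ-renameᶜ : {θ₁ : Fin n → Fin n′} {θ₂ : Fin n′ → Fin n″} {θ₃ : Fin n → Fin n″} →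
                  (∀ k → θ₂ (θ₁ k) ≡ θ₃ k) → (M : Term m n) → renameᶜ θ₂ (renameᶜ θ₁ M) ≡ renameᶜ θ₃ M
renameᶜ-renameᶜ q (var x)     = refl
renameᶜ-renameᶜ q (ƛ M)       = cong ƛ_ (renameᶜ-renameᶜ q M)
renameᶜ-renameᶜ q (M · N)     = cong₂ _·_ (renameᶜ-renameᶜ q M) (renameᶜ-renameᶜ q N)
renameᶜ-renameᶜ q (L Where M) = cong₂ _Where_ (renameᶜ-renameᶜ q L) (renameᶜ-renameᶜ q M)
renameᶜ-renameᶜ q (ε M)       = cong ε_ (renameᶜ-renameᶜ (lift-∘ q) M)
renameᶜ-renameᶜ q (throw k M) = cong₂ throw (q k) (renameᶜ-renameᶜ q M)

renameᶜ-comm : ∀ {b} {θ₁ : Fin n → Fin n′} {θ₂ : Fin n′ → Fin n″} {θ₃ : Fin n → Fin b} {θ₄ : Fin b → Fin n″} →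
               (∀ k → θ₂ (θ₁ k) ≡ θ₄ (θ₃ k)) → (M : Term m n) →
               renameᶜ θ₂ (renameᶜ θ₁ M) ≡ renameᶜ θ₄ (renameᶜ θ₃ M)
renameᶜ-comm q M = trans (renameᶜ-renameᶜ q M) (sym (renameᶜ-renameᶜ (λ _ → refl) M))

renameᶜ-weakenᶜ : (l : Fin n) (M : Term m n) → weakenᶜ M [ l ]ᶜ ≡ M
renameᶜ-weakenᶜ l M = trans (renameᶜ-renameᶜ (λ _ → refl) M) (renameᶜ-id (λ _ → refl) M)

renameᶜ-rename : (θ : Fin n → Fin n′) (ρ : Fin m → Fin m′) (M : Term m n) →
                 renameᶜ θ (rename ρ M) ≡ rename ρ (renameᶜ θ M)
renameᶜ-rename θ ρ (var x)     = refl
renameᶜ-rename θ ρ (ƛ M)       = cong ƛ_ (renameᶜ-rename θ _ M)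
renameᶜ-rename θ ρ (M · N)     = cong₂ _·_ (renameᶜ-rename θ ρ M) (renameᶜ-rename θ ρ N)
renameᶜ-rename θ ρ (L Where M) = cong₂ _Where_ (renameᶜ-rename θ _ L) (renameᶜ-rename θ ρ M)
renameᶜ-rename θ ρ (ε M)       = cong ε_ (renameᶜ-rename _ ρ M)
renameᶜ-rename θ ρ (throw k M) = cong (throw _) (renameᶜ-rename θ ρ M)

renameᶜ-subst : {θ : Fin n → Fin n′} {σ : Fin m → Term m′ n} {τ : Fin m → Term m′ n′} →
                (∀ x → renameᶜ θ (σ x) ≡ τ x) → (M : Term m n) → renameᶜ θ (subst σ M) ≡ subst τ (renameᶜ θ M)
renameᶜ-subst-ext : {θ : Fin n → Fin n′} {σ : Fin m → Term m′ n} {τ : Fin m → Term m′ n′} →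
                    (∀ x → renameᶜ θ (σ x) ≡ τ x) → (M : Term (suc m) n) →
                    renameᶜ θ (subst (var zero ∷ (weaken ∘ σ)) M) ≡ subst (var zero ∷ (weaken ∘ τ)) (renameᶜ θ M)
renameᶜ-subst p (var x)     = p x
renameᶜ-subst p (ƛ M)       = cong ƛ_ (renameᶜ-subst-ext p M)
renameᶜ-subst p (M · N)     = cong₂ _·_ (renameᶜ-subst p M) (renameᶜ-subst p N)
renameᶜ-subst p (L Where M) = cong₂ _Where_ (renameᶜ-subst-ext p L) (renameᶜ-subst p M)
renameᶜ-subst {σ = σ} p (ε M) = cong ε_
  (renameᶜ-subst (λ x → trans (renameᶜ-comm (λ _ → refl) (σ x)) (cong weakenᶜ (p x))) M)
renameᶜ-subst p (throw k M) = cong (throw _) (renameᶜ-subst p M)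
renameᶜ-subst-ext {θ = θ} {σ} p = renameᶜ-subst
  (λ { zero → refl ; (suc x) → trans (renameᶜ-rename θ suc (σ x)) (cong weaken (p x)) })

-- Injectivity at `k` prevents other throws from becoming throws to `θ k`, which would then be
-- replaced too.
renameᶜ-throw-↦ : {θ : Fin n → Fin n′} {k : Fin n} → (∀ j → θ j ≡ θ k → j ≡ k) →
                  (N : Term m n) (M : Term (suc m) n) →
                  renameᶜ θ (N ⟨throw k ↦ M ⟩) ≡ renameᶜ θ N ⟨throw θ k ↦ renameᶜ θ M ⟩
renameᶜ-throw-↦ q (var x) M = refl
renameᶜ-throw-↦ {θ = θ} {k} q (ƛ N) M = cong ƛ_ (trans (renameᶜ-throw-↦ q N _)
  (cong (renameᶜ θ N ⟨throw θ k ↦_⟩) (renameᶜ-rename θ (lift 1 suc) M)))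
renameᶜ-throw-↦ q (N · P) M = cong₂ _·_ (renameᶜ-throw-↦ q N M) (renameᶜ-throw-↦ q P M)
renameᶜ-throw-↦ {θ = θ} {k} q (N Where P) M = cong₂ _Where_ (trans (renameᶜ-throw-↦ q N _)
  (cong (renameᶜ θ N ⟨throw θ k ↦_⟩) (renameᶜ-rename θ (lift 1 suc) M))) (renameᶜ-throw-↦ q P M)
renameᶜ-throw-↦ {θ = θ} {k} q (ε N) M = cong ε_ (trans
  (renameᶜ-throw-↦ (λ { zero () ; (suc j) eq → cong suc (q j (suc-injective eq)) }) N _)
  (cong (renameᶜ (lift 1 θ) N ⟨throw suc (θ k) ↦_⟩) (renameᶜ-comm (λ _ → refl) M)))
renameᶜ-throw-↦ {θ = θ} {k} q (throw j Q) M with j ≟ k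
... | yes refl rewrite dec-true (θ j ≟ θ j) refl = cong (λ P → throw _ (_ Where P)) (renameᶜ-throw-↦ q Q M)
... | no j≢k rewrite dec-false (θ j ≟ θ k) (j≢k ∘ q j) = cong (throw _) (renameᶜ-throw-↦ q Q M)

throw-↦-unused : {θ : Fin n → Fin n′} {k : Fin n′} → (∀ j → ¬ θ j ≡ k) →
                 (N : Term m n) (M : Term (suc m) n′) → renameᶜ θ N ⟨throw k ↦ M ⟩ ≡ renameᶜ θ N
throw-↦-unused q (var x) M = refl
throw-↦-unused q (ƛ N) M = cong ƛ_ (throw-↦-unused q N _)
throw-↦-unused q (N · P) M = cong₂ _·_ (throw-↦-unused q N M) (throw-↦-unused q P M)
throw-↦-unused q (N Where P) M = cong₂ _Where_ (throw-↦-unused q N _) (throw-↦-unused q P M)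
throw-↦-unused q (ε N) M = cong ε_
  (throw-↦-unused (λ { zero () ; (suc j) eq → q j (suc-injective eq) }) N _)
throw-↦-unused {θ = θ} {k} q (throw j Q) M rewrite dec-false (θ j ≟ k) (q j) =
  cong (throw _) (throw-↦-unused q Q M)

ƛ-injective : {M N : Term (suc m) n} → _≡_ {A = Term m n} (ƛ M) (ƛ N) → M ≡ N
ƛ-injective refl = refl

·-injective : {M M′ N N′ : Term m n} → M · N ≡ M′ · N′ → M ≡ M′ × N ≡ N′
·-injective refl = refl , refl

Where-injective : {L L′ : Term (suc m) n} {M M′ : Term m n} → L Where M ≡ L′ Where M′ → L ≡ L′ × M ≡ M′
Where-injective refl = refl , refl

ε-injective : {M N : Term m (suc n)} → _≡_ {A = Term m n} (ε M) (ε N) → M ≡ N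
ε-injective refl = refl

throw-injective : ∀ {k l} {M N : Term m n} → throw k M ≡ throw l N → k ≡ l × M ≡ N
throw-injective refl = refl , refl

renameᶜ-pullback : ∀ {b} {θ₁ : Fin n → Fin n″} {θ₂ : Fin n′ → Fin n″} {θ₁′ : Fin b → Fin n} {θ₂′ : Fin b → Fin n′} →
  Square θ₁ θ₂ θ₁′ θ₂′ → (M : Term m n) (N : Term m n′) → renameᶜ θ₁ M ≡ renameᶜ θ₂ N →
  ∃[ P ] (M ≡ renameᶜ θ₁′ P × N ≡ renameᶜ θ₂′ P)
renameᶜ-pullback q (var x) (var .x) refl = var x , refl , refl
renameᶜ-pullback q (ƛ M) (ƛ N) eq with renameᶜ-pullback q M N (ƛ-injective eq)
... | P , refl , refl = ƛ P , refl , refl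
renameᶜ-pullback q (M · M₁) (N · N₁) eq with ·-injective eq
... | eq₁ , eq₂ with renameᶜ-pullback q M N eq₁ | renameᶜ-pullback q M₁ N₁ eq₂
... | P , refl , refl | P₁ , refl , refl = P · P₁ , refl , refl
renameᶜ-pullback q (M Where M₁) (N Where N₁) eq with Where-injective eq
... | eq₁ , eq₂ with renameᶜ-pullback q M N eq₁ | renameᶜ-pullback q M₁ N₁ eq₂
... | P , refl , refl | P₁ , refl , refl = P Where P₁ , refl , refl
renameᶜ-pullback q (ε M) (ε N) eq with renameᶜ-pullback (lift-Square q) M N (ε-injective eq)
... | P , refl , refl = ε P , refl , refl
renameᶜ-pullback q (throw k M) (throw l N) eq with throw-injective eq
... | eq₁ , eq₂ with q k l eq₁ | renameᶜ-pullback q M N eq₂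
... | j , refl , refl | P , refl , refl = throw j P , refl , refl

weakenᶜ-injective : {M N : Term m n} → weakenᶜ M ≡ weakenᶜ N → M ≡ N
weakenᶜ-injective {M = M} {N} eq with renameᶜ-pullback suc-mono-Square M N eq
... | P , refl , refl = refl

-- The two index spaces are independent, so every such square is a pullback. It carries freshness of
-- a variable back along a continuation renaming, and freshness of a tag back along a variable
-- renaming.
rename-pullback : (θ : Fin n → Fin n′) (ρ : Fin m → Fin m′) (M : Term m′ n) (N : Term m n′) →
                  renameᶜ θ M ≡ rename ρ N → ∃[ P ] (M ≡ rename ρ P × N ≡ renameᶜ θ P)
rename-pullback θ ρ (var x) (var y) refl = var y , refl , refl
rename-pullback θ ρ (ƛ M) (ƛ N) eq with rename-pullback θ (lift 1 ρ) M N (ƛ-injective eq)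
... | P , refl , refl = ƛ P , refl , refl
rename-pullback θ ρ (M · M₁) (N · N₁) eq with ·-injective eq
... | eq₁ , eq₂ with rename-pullback θ ρ M N eq₁ | rename-pullback θ ρ M₁ N₁ eq₂
... | P , refl , refl | P₁ , refl , refl = P · P₁ , refl , refl
rename-pullback θ ρ (M Where M₁) (N Where N₁) eq with Where-injective eq
... | eq₁ , eq₂ with rename-pullback θ (lift 1 ρ) M N eq₁ | rename-pullback θ ρ M₁ N₁ eq₂
... | P , refl , refl | P₁ , refl , refl = P Where P₁ , refl , refl
rename-pullback θ ρ (ε M) (ε N) eq with rename-pullback (lift 1 θ) ρ M N (ε-injective eq)
... | P , refl , refl = ε P , refl , refl
rename-pullback θ ρ (throw k M) (throw l N) eq with throw-injective eq
... | refl , eq₂ with rename-pullback θ ρ M N eq₂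
... | P , refl , refl = throw k P , refl , refl

-- Substitution erases no continuation variable: all free ones of `M` still occur in `subst σ M`.
-- Hence a used tag stays used.
subst-image : (θ : Fin n → Fin n′) {σ : Fin m → Term m′ n′} (N : Term m′ n) (M : Term m n′) →
              renameᶜ θ N ≡ subst σ M → ∃[ P ] M ≡ renameᶜ θ P
subst-image θ N (var x) eq = var x , refl
subst-image θ (ƛ N) (ƛ M) eq with subst-image θ N M (ƛ-injective eq)
... | P , refl = ƛ P , refl
subst-image θ (N · N₁) (M · M₁) eq with ·-injective eq
... | eq₁ , eq₂ with subst-image θ N M eq₁ | subst-image θ N₁ M₁ eq₂
... | P , refl | P₁ , refl = P · P₁ , refl
subst-image θ (N Where N₁) (M Where M₁) eq with Where-injective eq
... | eq₁ , eq₂ with subst-image θ N M eq₁ | subst-image θ N₁ M₁ eq₂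
... | P , refl | P₁ , refl = P Where P₁ , refl
subst-image θ (ε N) (ε M) eq with subst-image (lift 1 θ) N M (ε-injective eq)
... | P , refl = ε P , refl
subst-image θ (throw k N) (throw l M) eq with throw-injective eq
... | refl , eq₂ with subst-image θ N M eq₂
... | P , refl = throw k P , refl

renameᶜ-value : {θ : Fin n → Fin n′} {M : Term m n} → Value M → Value (renameᶜ θ M)
renameᶜ-value (var x) = var x
renameᶜ-value (ƛ M)   = ƛ renameᶜ _ M

renameᶜ-value⁻¹ : {θ : Fin n → Fin n′} (M : Term m n) → Value (renameᶜ θ M) → Value M
renameᶜ-value⁻¹ (var x) _ = var x
renameᶜ-value⁻¹ (ƛ M)   _ = ƛ M

-- Reflection of reduction along continuation renamings

Reflects : (Fin n → Fin n′) → (∀ {m n} → Term m n → Term m n → Set) → Term m n′ → Term m n′ → Set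
Reflects {n = n} {m = m} θ R X Y = (M : Term m n) → X ≡ renameᶜ θ M → ∃[ N ] (R M N × Y ≡ renameᶜ θ N)

reflects-structural : {θ : Fin n → Fin n′} {X Y : Term m n′} → Structural X Y → Reflects θ _≅_ X Y
reflects-structural {θ = θ} (where-where _ _ _) (L Where (M Where N)) refl =
  _ , base (where-where L M N) , cong (λ P → P Where _ Where _) (sym (renameᶜ-rename θ _ L))
reflects-structural {θ = θ} (ε-where _ _) (ε M Where N) refl =
  _ , base (ε-where M N) , cong (λ P → ε (_ Where P)) (renameᶜ-comm (λ _ → refl) N)
reflects-structural (throw-where _ _ _) (throw k M Where N) refl = _ , base (throw-where k M N) , refl

reflects-structural⁻¹ : {θ : Fin n → Fin n′} {X Y : Term m n′} → Structural X Y → Reflects θ _≅_ Y X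
reflects-structural⁻¹ {θ = θ} (where-where L _ _) (L′ Where M Where N) eq with Where-injective eq
... | eq₁ , refl with Where-injective eq₁
... | eq₂ , refl with rename-pullback θ (lift 1 suc) L′ L (sym eq₂)
... | P , refl , refl = _ , Congruence.sym (base (where-where P M N)) , refl
reflects-structural⁻¹ (ε-where _ N) (ε (M Where N′)) eq with Where-injective (ε-injective eq)
... | refl , eq₂ with renameᶜ-pullback suc-Square N′ N (sym eq₂)
... | P , refl , refl = _ , Congruence.sym (base (ε-where M P)) , refl
reflects-structural⁻¹ (throw-where _ _ _) (throw k (M Where N)) refl =
  _ , Congruence.sym (base (throw-where k M N)) , refl

-- Both directions are proved at once because `sym` exchanges them.
reflects-≅ : {θ : Fin n → Fin n′} {X Y : Term m n′} → X ≅ Y → Reflects θ _≅_ X Y × Reflects θ _≅_ Y X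
reflects-≅ (base r) = reflects-structural r , reflects-structural⁻¹ r
reflects-≅ refl = (λ M eq → M , refl , eq) , (λ M eq → M , refl , eq)
reflects-≅ (Congruence.sym p) = swap (reflects-≅ p)
reflects-≅ {θ = θ} (Congruence.trans p q) =
  (λ M eq → chain (proj₁ (reflects-≅ p)) (proj₁ (reflects-≅ q)) M eq) ,
  (λ M eq → chain (proj₂ (reflects-≅ q)) (proj₂ (reflects-≅ p)) M eq)
  where
  chain : ∀ {X Y Z} → Reflects θ _≅_ X Y → Reflects θ _≅_ Y Z → Reflects θ _≅_ X Z
  chain f g M eq with f M eq
  ... | N , r , eq′ with g N eq′
  ... | P , r′ , eq″ = P , Congruence.trans r r′ , eq″
reflects-≅ {θ = θ} (ƛ p) = congr (proj₁ (reflects-≅ p)) , congr (proj₂ (reflects-≅ p))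
  where
  congr : ∀ {X Y} → Reflects θ _≅_ X Y → Reflects θ _≅_ (ƛ X) (ƛ Y)
  congr f (ƛ M) refl with f M refl
  ... | N , r , refl = ƛ N , ƛ r , refl
reflects-≅ {θ = θ} (p · q) =
  congr (proj₁ (reflects-≅ p)) (proj₁ (reflects-≅ q)) , congr (proj₂ (reflects-≅ p)) (proj₂ (reflects-≅ q))
  where
  congr : ∀ {X Y X′ Y′} → Reflects θ _≅_ X Y → Reflects θ _≅_ X′ Y′ → Reflects θ _≅_ (X · X′) (Y · Y′)
  congr f g (M · M′) refl with f M refl | g M′ refl
  ... | N , r , refl | N′ , r′ , refl = N · N′ , r · r′ , refl
reflects-≅ {θ = θ} (p Where q) =
  congr (proj₁ (reflects-≅ p)) (proj₁ (reflects-≅ q)) , congr (proj₂ (reflects-≅ p)) (proj₂ (reflects-≅ q))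
  where
  congr : ∀ {X Y X′ Y′} → Reflects θ _≅_ X Y → Reflects θ _≅_ X′ Y′ → Reflects θ _≅_ (X Where X′) (Y Where Y′)
  congr f g (M Where M′) refl with f M refl | g M′ refl
  ... | N , r , refl | N′ , r′ , refl = N Where N′ , r Where r′ , refl
reflects-≅ {θ = θ} (ε p) = congr (proj₁ (reflects-≅ p)) , congr (proj₂ (reflects-≅ p))
  where
  congr : ∀ {X Y} → Reflects (lift 1 θ) _≅_ X Y → Reflects θ _≅_ (ε X) (ε Y)
  congr f (ε M) refl with f M refl
  ... | N , r , refl = ε N , ε r , refl
reflects-≅ {θ = θ} (throw p) = congr (proj₁ (reflects-≅ p)) , congr (proj₂ (reflects-≅ p))
  where
  congr : ∀ {k X Y} → Reflects θ _≅_ X Y → Reflects θ _≅_ (throw k X) (throw k Y)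
  congr f (throw k M) refl with f M refl
  ... | N , r , refl = throw k N , throw r , refl

reflects-rule : {θ : Fin n → Fin n′} {X Y : Term m n′} → Rule X Y → Reflects θ Rule X Y
reflects-rule {θ = θ} (nonvalue-app _ nv) (N · M) refl =
  _ , nonvalue-app M (nv ∘ renameᶜ-value) ,
  cong (λ P → (var zero · P) Where _) (sym (renameᶜ-rename θ suc M))
reflects-rule {θ = θ} (value-app v nv) (V · N) refl =
  _ , value-app (renameᶜ-value⁻¹ V v) (nv ∘ renameᶜ-value) ,
  cong (λ P → (P · var zero) Where _) (sym (renameᶜ-rename θ suc V))
reflects-rule (β _ v) (ƛ M · V) refl = _ , β M (renameᶜ-value⁻¹ V v) , refl
reflects-rule (where-value _ v) (M Where V) refl =
  _ , where-value M (renameᶜ-value⁻¹ V v) ,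
  sym (renameᶜ-subst (λ { zero → refl ; (suc x) → refl }) M)
reflects-rule {θ = θ} (η {V} v) (ƛ (A · var zero)) eq with ·-injective (ƛ-injective eq)
... | eqA , _ with rename-pullback θ suc A V (sym eqA)
... | P , refl , refl = P , η (renameᶜ-value⁻¹ P v) , refl
reflects-rule (where-id _) (var zero Where M) refl = M , where-id M , refl
reflects-rule (ε-unused N) (ε M) eq with renameᶜ-pullback suc-Square M N (sym (ε-injective eq))
... | P , refl , refl = P , ε-unused P , refl
reflects-rule (ε-throw _) (ε throw k M) eq with throw-injective (ε-injective eq)
... | eqk , refl with lift-zero k eqk
... | refl = _ , ε-throw M , refl
reflects-rule (where-throw _ _ _) (M Where throw k N) refl = _ , where-throw M k N , refl
reflects-rule (throw-throw _ _ _) (throw l (throw k N)) refl = _ , throw-throw l k N , refl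
reflects-rule {θ = θ} (where-ε _ _) (M Where (ε N)) refl = _ , where-ε M N ,
  cong ε_ (cong₂ _Where_ (renameᶜ-comm (λ _ → refl) M)
    (trans (cong (renameᶜ (lift 1 θ) N ⟨throw zero ↦_⟩) (renameᶜ-comm (λ _ → refl) M))
           (sym (renameᶜ-throw-↦ (λ j eq → lift-zero j (sym eq)) N (weakenᶜ M)))))
reflects-rule (throw-ε _ _) (throw l (ε M)) refl = _ , throw-ε l M ,
  cong (throw _) (renameᶜ-comm (λ { zero → refl ; (suc k) → refl }) M)
reflects-rule (ε-ε _) (ε (ε M)) refl = _ , ε-ε M ,
  cong ε_ (renameᶜ-comm (λ { zero → refl ; (suc k) → refl }) M)

reflects-compatible : {θ : Fin n → Fin n′} {X Y : Term m n′} →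
                      Compatible Rule X Y → Reflects θ (Compatible Rule) X Y
reflects-compatible (base r) M eq with reflects-rule r M eq
... | N , r′ , eq′ = N , base r′ , eq′
reflects-compatible (ƛ r) (ƛ M) refl with reflects-compatible r M refl
... | N , r′ , refl = _ , ƛ r′ , refl
reflects-compatible (·ˡ r) (M · P) refl with reflects-compatible r M refl
... | N , r′ , refl = _ , ·ˡ r′ , refl
reflects-compatible (·ʳ r) (P · M) refl with reflects-compatible r M refl
... | N , r′ , refl = _ , ·ʳ r′ , refl
reflects-compatible (Whereˡ r) (M Where P) refl with reflects-compatible r M refl
... | N , r′ , refl = _ , Whereˡ r′ , refl
reflects-compatible (Whereʳ r) (P Where M) refl with reflects-compatible r M refl
... | N , r′ , refl = _ , Whereʳ r′ , refl
reflects-compatible (ε r) (ε M) refl with reflects-compatible r M refl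
... | N , r′ , refl = _ , ε r′ , refl
reflects-compatible (throw r) (throw k M) refl with reflects-compatible r M refl
... | N , r′ , refl = _ , throw r′ , refl

reflects-⟶* : {θ : Fin n → Fin n′} {X Y : Term m n′} → X ⟶* Y → Reflects θ _⟶*_ X Y
reflects-⟶* (done p) M eq with proj₁ (reflects-≅ p) M eq
... | N , r , eq′ = N , done r , eq′
reflects-⟶* (step (_ , _ , p , r , q) rs) M eq with proj₁ (reflects-≅ p) M eq
... | M₁ , p′ , eq₁ with reflects-compatible r M₁ eq₁
... | M₂ , r′ , eq₂ with proj₁ (reflects-≅ q) M₂ eq₂
... | M₃ , q′ , eq₃ with reflects-⟶* rs M₃ eq₃
... | N , rs′ , eq₄ = N , step (_ , _ , p′ , r′ , q′) rs′ , eq₄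

Image : (Fin n → Fin n′) → Term m n′ → Set
Image {n = n} {m = m} θ M = ∃[ N ] M ≡ renameᶜ {n = n} {m = m} θ N

image? : {θ : Fin n → Fin n′} → (∀ k → Dec (∃[ j ] k ≡ θ j)) → (M : Term m n′) → Dec (Image θ M)
image? q (var x) = yes (var x , refl)
image? q (ƛ M) with image? q M
... | yes (N , refl) = yes (ƛ N , refl)
... | no ¬p = no λ { (ƛ N , refl) → ¬p (N , refl) }
image? q (M · M′) with image? q M | image? q M′
... | yes (N , refl) | yes (N′ , refl) = yes (N · N′ , refl)
... | no ¬p | _ = no λ { (N · N′ , refl) → ¬p (N , refl) }
... | _ | no ¬p = no λ { (N · N′ , refl) → ¬p (N′ , refl) }
image? q (M Where M′) with image? q M | image? q M′
... | yes (N , refl) | yes (N′ , refl) = yes (N Where N′ , refl)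
... | no ¬p | _ = no λ { (N Where N′ , refl) → ¬p (N , refl) }
... | _ | no ¬p = no λ { (N Where N′ , refl) → ¬p (N′ , refl) }
image? {θ = θ} q (ε M) with image? lifted M
  where
  lifted : ∀ k → Dec (∃[ j ] k ≡ lift 1 θ j)
  lifted zero = yes (zero , refl)
  lifted (suc k) with q k
  ... | yes (j , refl) = yes (suc j , refl)
  ... | no ¬p = no λ { (suc j , eq) → ¬p (j , suc-injective eq) }
... | yes (N , refl) = yes (ε N , refl)
... | no ¬p = no λ { (ε N , refl) → ¬p (N , refl) }
image? q (throw k M) with q k | image? q M
... | yes (j , refl) | yes (N , refl) = yes (throw j N , refl)
... | no ¬p | _ = no λ { (throw j N , refl) → ¬p (j , refl) }
... | _ | no ¬p = no λ { (throw j N , refl) → ¬p (N , refl) }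

unused? : (M : Term m (suc n)) → Dec (Image suc M)
unused? = image? λ { zero → no λ () ; (suc k) → yes (k , refl) }

-- ε with the rule  ε-unused  applied whenever possible.
block : Term m (suc n) → Term m n
block M with unused? M
... | yes (N , _) = N
... | no _        = ε M

-- The graph of `block`. Preimages under `weakenᶜ` are unique, so `block-unique` evaluates `block`
-- from any preimage, without running the decision procedure.
data Block (M : Term m (suc n)) : Term m n → Set where
  unused : ∀ {N} → M ≡ weakenᶜ N → Block M N
  used   : ¬ Image suc M → Block M (ε M)

block-view : (M : Term m (suc n)) → Block M (block M)
block-view M with unused? M
... | yes (N , eq) = unused eq
... | no ¬p        = used ¬p

block-unique : {M : Term m (suc n)} {N : Term m n} → Block M N → block M ≡ N
block-unique {M = M} b with block M | block-view M | b
... | _ | unused refl | unused eq = weakenᶜ-injective eq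
... | _ | unused refl | used ¬p   = contradiction (_ , refl) ¬p
... | _ | used ¬p     | unused eq = contradiction (_ , eq) ¬p
... | _ | used _      | used _    = refl

block-weakenᶜ : (M : Term m n) → block (weakenᶜ M) ≡ M
block-weakenᶜ M = block-unique (unused refl)

ε⟶*block : (M : Term m (suc n)) → ε M ⟶* block M
ε⟶*block M with block M | block-view M
... | N | unused refl = rule (ε-unused N)
... | _ | used _      = done refl

block-⟶* : {M N : Term m (suc n)} → M ⟶* N → block M ⟶* block N
block-⟶* {M = M} {N} r with block M | block-view M
... | P | unused eq with reflects-⟶* r P eq
... | Q , r′ , refl = ⟶*-trans r′ (≡⇒⟶* (sym (block-weakenᶜ Q)))
block-⟶* {M = M} {N} r | _ | used _ = ⟶*-trans (ε-⟶* r) (ε⟶*block N)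

rename-block : (ρ : Fin m → Fin m′) (M : Term m (suc n)) → rename ρ (block M) ≡ block (rename ρ M)
rename-block ρ M with block M | block-view M
... | N | unused refl = sym (block-unique (unused (sym (renameᶜ-rename suc ρ N))))
... | _ | used ¬p = sym (block-unique (used λ { (N , eq) → ¬p (image N (rename-pullback suc ρ N M (sym eq))) }))
  where
  image : ∀ N → ∃[ P ] (N ≡ rename ρ P × M ≡ renameᶜ suc P) → Image suc M
  image N (P , _ , eq) = P , eq

renameᶜ-block : (θ : Fin n → Fin n′) (M : Term m (suc n)) → renameᶜ θ (block M) ≡ block (renameᶜ (lift 1 θ) M)
renameᶜ-block θ M with block M | block-view M
... | N | unused refl = sym (block-unique (unused (renameᶜ-comm (λ _ → refl) N)))
... | _ | used ¬p = sym (block-unique (used λ { (N , eq) → ¬p (image (renameᶜ-pullback suc-Square M N eq)) }))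
  where
  image : ∀ {N} → ∃[ P ] (M ≡ renameᶜ suc P × N ≡ renameᶜ θ P) → Image suc M
  image (P , eq , _) = P , eq

subst-block : (σ : Fin m → Term m′ n) (M : Term m (suc n)) → subst σ (block M) ≡ block (subst (weakenᶜ ∘ σ) M)
subst-block σ M with block M | block-view M
... | N | unused refl = sym (block-unique (unused (sym (renameᶜ-subst (λ _ → refl) N))))
... | _ | used ¬p = sym (block-unique (used λ { (N , eq) → ¬p (subst-image suc N M (sym eq)) }))

block-throw-↦ : (M : Term m (suc n)) (k : Fin n) (P : Term (suc m) n) →
                block M ⟨throw k ↦ P ⟩ ⟶* block (M ⟨throw suc k ↦ weakenᶜ P ⟩)
block-throw-↦ M k P with block M | block-view M
... | N | unused refl = ≡⇒⟶* (sym (block-unique (unused (sym (renameᶜ-throw-↦ (λ _ → suc-injective) N P)))))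
... | _ | used _ = ε⟶*block (M ⟨throw suc k ↦ weakenᶜ P ⟩)

block-block : (M : Term m (suc (suc n))) → block (block M) ⟶* block (M [ zero ]ᶜ)
block-block M with block M | block-view M
... | N | unused refl = ≡⇒⟶* (cong block (sym (renameᶜ-weakenᶜ zero N)))
... | _ | used _ with block (ε M) | block-view (ε M)
-- The inner tag is used and the outer one is not, so identifying the two merely undoes the
-- weakening.
... | ε N | unused refl = ⟶*-trans (ε⟶*block N) (≡⇒⟶* (cong block (sym
  (trans (renameᶜ-renameᶜ (λ { zero → refl ; (suc k) → refl }) N) (renameᶜ-id (λ _ → refl) N)))))
... | _ | used _ = ⟶*-trans (rule (ε-ε M)) (ε⟶*block (M [ zero ]ᶜ))

block-throw : (M : Term m (suc n)) → block (throw zero M) ⟶* block M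
block-throw M = ⟶*-trans (≡⇒⟶* (block-unique (used
    λ { (throw _ _ , ()) ; (var _ , ()) ; (ƛ _ , ()) ; (_ · _ , ()) ; (_ Where _ , ()) ; (ε _ , ()) })))
  (⟶*-trans (rule (ε-throw M)) (ε⟶*block M))

block-where : (M : Term (suc m) (suc n)) (N : Term m n) → block M Where N ⟶* block (M Where weakenᶜ N)
block-where M N with block M | block-view M
... | P | unused refl = ≡⇒⟶* (sym (block-unique (unused refl)))
... | _ | used _ = ⟶*-trans (structural (ε-where M N)) (ε⟶*block (M Where weakenᶜ N))

where-block : (M : Term (suc m) n) (N : Term m (suc n)) →
              M Where block N ⟶* block (weakenᶜ M Where (N ⟨throw zero ↦ weakenᶜ M ⟩))
where-block M N with block N | block-view N
... | P | unused refl = ≡⇒⟶* (sym (block-unique (unused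
  (cong (weakenᶜ M Where_) (throw-↦-unused (λ _ ()) P (weakenᶜ M))))))
... | _ | used _ = ⟶*-trans (rule (where-ε M N)) (ε⟶*block _)

throw-block : (l : Fin n) (M : Term m (suc n)) → throw l (block M) ⟶* throw l (M [ l ]ᶜ)
throw-block l M with block M | block-view M
... | N | unused refl = ≡⇒⟶* (cong (throw l) (sym (renameᶜ-weakenᶜ l N)))
... | _ | used _ = rule (throw-ε l M)

-- Reading commands back

var-zero? : (L : Term (suc m) n) → Dec (L ≡ var zero)
var-zero? (var zero)    = yes refl
var-zero? (var (suc _)) = no λ ()
var-zero? (ƛ _)         = no λ ()
var-zero? (_ · _)       = no λ ()
var-zero? (_ Where _)   = no λ ()
var-zero? (ε _)         = no λ ()
var-zero? (throw _ _)   = no λ ()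

-- _Where_ with the rule  where-id  applied whenever possible.
let′ : Term (suc m) n → Term m n → Term m n
let′ L N with var-zero? L
... | yes _ = N
... | no _  = L Where N

let′-proper : {L : Term (suc m) n} {N : Term m n} → ¬ L ≡ var zero → let′ L N ≡ L Where N
let′-proper {L = L} ¬p with var-zero? L
... | yes p = contradiction p ¬p
... | no _  = refl

Where⟶*let′ : (L : Term (suc m) n) (N : Term m n) → L Where N ⟶* let′ L N
Where⟶*let′ L N with var-zero? L
... | yes refl = rule (where-id N)
... | no _     = done refl

rename-let′ : (ρ : Fin m → Fin m′) (L : Term (suc m) n) (N : Term m n) →
              rename ρ (let′ L N) ≡ let′ (rename (lift 1 ρ) L) (rename ρ N)
rename-let′ ρ L N with var-zero? L
... | yes refl = refl
... | no ¬p = sym (let′-proper (proper L ¬p))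
  where
  proper : ∀ L → ¬ L ≡ var zero → ¬ rename (lift 1 ρ) L ≡ var zero
  proper (var zero)    ¬p _  = ¬p refl

renameᶜ-let′ : (θ : Fin n → Fin n′) (L : Term (suc m) n) (N : Term m n) →
               renameᶜ θ (let′ L N) ≡ let′ (renameᶜ θ L) (renameᶜ θ N)
renameᶜ-let′ θ L N with var-zero? L
... | yes refl = refl
... | no ¬p = sym (let′-proper (proper L ¬p))
  where
  proper : ∀ L → ¬ L ≡ var zero → ¬ renameᶜ θ L ≡ var zero
  proper (var zero)    ¬p _  = ¬p refl

-- The terms put in for the outer variables are weakened under the binder, hence never `var zero`,
-- and the test has the same outcome on both sides.
subst-let′ : (σ : Fin m → Term m′ n) (L : Term (suc m) n) (N : Term m n) →
             subst σ (let′ L N) ≡ let′ (subst (var zero ∷ (weaken ∘ σ)) L) (subst σ N)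
subst-let′ σ L N with var-zero? L
... | yes refl = refl
... | no ¬p = sym (let′-proper (proper L ¬p))
  where
  weaken-proper : ∀ M → ¬ weaken M ≡ var zero
  weaken-proper (var _) ()
  proper : ∀ L → ¬ L ≡ var zero → ¬ subst (var zero ∷ (weaken ∘ σ)) L ≡ var zero
  proper (var zero)    ¬p _  = ¬p refl
  proper (var (suc x)) ¬p eq = weaken-proper (σ x) eq

-- Index zero is the tag of the block that `close` puts around; a throw to it is dropped as in
-- `ε-throw`.
thr : Fin (suc n) → Term m (suc n) → Term m (suc n)
thr zero    M = M
thr (suc k) M = throw (suc k) M

tail : Cmd m n → Fin n
tail (ret k W)   = k
tail (app A B J) = tail J

-- On a command the final  throw (tail J)  is omitted.
back : Exp s m n → Term m n
back (atom x)    = var x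
back (lam J)     = ƛ block (thr (tail J) (back J))
back (ret k W)   = back W
back (app A B J) = let′ (back J) (back A · back B)

-- The clause for `lam` in `back` spells this term out, so `back (lam J)` computes to `ƛ close J`.
close : Cmd m (suc n) → Term m n
close J = block (thr (tail J) (back J))

back-value : (W : Val m n) → Value (back W)
back-value (atom x) = var x
back-value (lam J)  = ƛ _

thr-⟶* : (k : Fin (suc n)) {M N : Term m (suc n)} → M ⟶* N → thr k M ⟶* thr k N
thr-⟶* zero    r = r
thr-⟶* (suc k) r = throw-⟶* r

thr-where : (k : Fin (suc n)) (M : Term (suc m) (suc n)) (N : Term m (suc n)) →
            thr k M Where N ⟶* thr k (M Where N)
thr-where zero    M N = done refl
thr-where (suc k) M N = structural (throw-where (suc k) M N)

block-thr : (k : Fin (suc n)) (M : Term m (suc n)) → block (throw k M) ⟶* block (thr k M)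
block-thr zero    M = block-throw M
block-thr (suc k) M = done refl

rename-id : {ρ : Fin m → Fin m} → (∀ x → ρ x ≡ x) → (M : Term m n) → rename ρ M ≡ M
rename-id p (var x)     = cong var (p x)
rename-id p (ƛ M)       = cong ƛ_ (rename-id (lift-id p) M)
rename-id p (M · N)     = cong₂ _·_ (rename-id p M) (rename-id p N)
rename-id p (L Where M) = cong₂ _Where_ (rename-id (lift-id p) L) (rename-id p M)
rename-id p (ε M)       = cong ε_ (rename-id p M)
rename-id p (throw k M) = cong (throw k) (rename-id p M)

tail-ren : (ρ : Fin m → Fin m′) (θ : Fin n → Fin n′) (J : Cmd m n) → tail (ren ρ θ J) ≡ θ (tail J)
tail-ren ρ θ (ret k W)   = refl
tail-ren ρ θ (app A B J) = tail-ren (lift 1 ρ) θ J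

back-ren : (ρ : Fin m → Fin m′) (θ : Fin n → Fin n′) (E : Exp s m n) →
           back (ren ρ θ E) ≡ renameᶜ θ (rename ρ (back E))
close-ren : (ρ : Fin m → Fin m′) (θ : Fin n → Fin n′) (J : Cmd m (suc n)) →
            close (ren ρ (lift 1 θ) J) ≡ renameᶜ θ (rename ρ (close J))
back-ren ρ θ (atom x)    = refl
back-ren ρ θ (lam J)     = cong ƛ_ (close-ren (lift 1 ρ) θ J)
back-ren ρ θ (ret k W)   = back-ren ρ θ W
back-ren ρ θ (app A B J) = trans
  (cong₂ let′ (back-ren (lift 1 ρ) θ J) (cong₂ _·_ (back-ren ρ θ A) (back-ren ρ θ B)))
  (sym (trans (cong (renameᶜ θ) (rename-let′ ρ (back J) _)) (renameᶜ-let′ θ (rename (lift 1 ρ) (back J)) _)))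
close-ren ρ θ J = trans
  (cong block (trans (cong₂ thr (tail-ren ρ (lift 1 θ) J) (back-ren ρ (lift 1 θ) J)) (renames-thr (tail J) (back J))))
  (sym (trans (cong (renameᶜ θ) (rename-block ρ (thr (tail J) (back J)))) (renameᶜ-block θ (rename ρ (thr (tail J) (back J))))))
  where
  renames-thr : ∀ k M → thr (lift 1 θ k) (renameᶜ (lift 1 θ) (rename ρ M)) ≡ renameᶜ (lift 1 θ) (rename ρ (thr k M))
  renames-thr zero    M = refl
  renames-thr (suc k) M = refl

back-renᶜ : {ρ : Fin m → Fin m} (θ : Fin n → Fin n′) → (∀ x → ρ x ≡ x) → (E : Exp s m n) →
            back (ren ρ θ E) ≡ renameᶜ θ (back E)
back-renᶜ {ρ = ρ} θ p E = trans (back-ren ρ θ E) (cong (renameᶜ θ) (rename-id p (back E)))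

back-renᵛ : (ρ : Fin m → Fin m′) (E : Exp s m n) → back (ren ρ id E) ≡ rename ρ (back E)
back-renᵛ ρ E = trans (back-ren ρ id E) (renameᶜ-id (λ _ → refl) _)

tail-subv : (σ : Fin m → Val m′ n′) (θ : Fin n → Fin n′) (J : Cmd m n) → tail (subv σ θ J) ≡ θ (tail J)
tail-subv σ θ (ret k W)   = refl
tail-subv σ θ (app A B J) = tail-subv (extv σ) θ J

-- `θ` is pointwise the identity rather than `id`, because `lam` turns `id` into `lift 1 id`.
back-subv : {σ : Fin m → Val m′ n} {θ : Fin n → Fin n} {τ : Fin m → Term m′ n} →
            (∀ x → back (σ x) ≡ τ x) → (∀ k → θ k ≡ k) →
            (E : Exp s m n) → back (subv σ θ E) ≡ subst τ (back E)
close-subv : {σ : Fin m → Val m′ (suc n)} {θ : Fin (suc n) → Fin (suc n)} {τ : Fin m → Term m′ n} →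
             (∀ x → back (σ x) ≡ weakenᶜ (τ x)) → (∀ k → θ k ≡ k) →
             (J : Cmd m (suc n)) → close (subv σ θ J) ≡ subst τ (close J)
back-subv p q (atom x) = p x
back-subv {σ = σ} p q (lam J) = cong ƛ_ (close-subv
  (λ { zero → refl ; (suc x) → trans (back-ren suc suc (σ x)) (cong (weakenᶜ ∘ weaken) (p x)) }) (lift-id q) J)
back-subv p q (ret k W) = back-subv p q W
back-subv {σ = σ} {τ = τ} p q (app A B J) = trans
  (cong₂ let′ (back-subv (λ { zero → refl ; (suc x) → trans (back-renᵛ suc (σ x)) (cong weaken (p x)) }) q J)
              (cong₂ _·_ (back-subv p q A) (back-subv p q B)))
  (sym (subst-let′ τ (back J) _))
close-subv {σ = σ} {θ} {τ} p q J = trans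
  (cong block (trans (cong₂ thr (trans (tail-subv σ θ J) (q (tail J))) (back-subv p q J)) (subst-thr (tail J) (back J))))
  (sym (subst-block τ (thr (tail J) (back J))))
  where
  subst-thr : ∀ k M → thr k (subst (weakenᶜ ∘ τ) M) ≡ subst (weakenᶜ ∘ τ) (thr k M)
  subst-thr zero    M = refl
  subst-thr (suc k) M = refl

-- Sends the final return to a fresh continuation zero. Closing the result gives `back J`, by
-- `close-untail`, and renaming zero to `tail J` restores `J`, by `retail`.
untail : Cmd m n → Cmd m (suc n)
untail (ret k W)   = ret zero (ren id suc W)
untail (app A B J) = app (ren id suc A) (ren id suc B) (untail J)

tail-untail : (J : Cmd m n) → tail (untail J) ≡ zero
tail-untail (ret k W)   = refl
tail-untail (app A B J) = tail-untail J

back-untail : (J : Cmd m n) → back (untail J) ≡ weakenᶜ (back J)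
back-untail (ret k W)   = back-renᶜ suc (λ _ → refl) W
back-untail (app A B J) = trans
  (cong₂ let′ (back-untail J) (cong₂ _·_ (back-renᶜ suc (λ _ → refl) A) (back-renᶜ suc (λ _ → refl) B)))
  (sym (renameᶜ-let′ suc (back J) _))

close-untail : (J : Cmd m n) → close (untail J) ≡ back J
close-untail J = trans (cong₂ (λ k M → block (thr k M)) (tail-untail J) (back-untail J)) (block-weakenᶜ (back J))

ren-strengthen : {ρ : Fin m → Fin m} (k : Fin n) → (∀ x → ρ x ≡ x) →
                 (E : Exp s m n) → ren ρ (k ∷ id) (ren id suc E) ≡ E
ren-strengthen k p E = trans (ren-ren p (λ _ → refl) E) (ren-id (λ _ → refl) (λ _ → refl) E)

retail : {ρ : Fin m → Fin m} → (∀ x → ρ x ≡ x) → (J : Cmd m n) → ren ρ (tail J ∷ id) (untail J) ≡ J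
retail p (ret k W)   = cong (ret k) (ren-strengthen k p W)
retail p (app A B J) =
  cong₃ app (ren-strengthen (tail J) p A) (ren-strengthen (tail J) p B) (retail (lift-id p) J)

throw-close : (l : Fin n) (J : Cmd m (suc n)) → throw l (close J) ⟶*
              throw (tail (ren id (l ∷ id) J)) (back (ren id (l ∷ id) J))
throw-close l J = ⟶*-trans (throw-block l (thr (tail J) (back J)))
  (⟶*-trans (collapse (tail J) (back J))
    (≡⇒⟶* (sym (cong₂ throw (tail-ren id (l ∷ id) J) (back-renᶜ (l ∷ id) (λ _ → refl) J)))))
  where
  collapse : ∀ k M → throw l (thr k M [ l ]ᶜ) ⟶* throw ((l ∷ id) k) (M [ l ]ᶜ)
  collapse zero    M = done refl
  collapse (suc k) M = rule (throw-throw l k _)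

-- The inner block is merged with the target `l` of the surrounding throw by `throw-ε`. If `l` is
-- the enclosing block, that throw is absent and `ε-ε` merges the two blocks.
block-thr-close : (l : Fin (suc n)) (J : Cmd m (suc (suc n))) →
                  block (thr l (close J)) ⟶* close (ren id (l ∷ id) J)
block-thr-close (suc l) J = ⟶*-trans (block-⟶* (throw-close (suc l) J)) (block-thr (tail (ren id (suc l ∷ id) J)) _)
block-thr-close zero J = ⟶*-trans (block-block (thr (tail J) (back J)))
  (⟶*-trans (collapse (tail J) (back J))
    (≡⇒⟶* (sym (cong₂ (λ k M → block (thr k M)) (tail-ren id (zero ∷ id) J) (back-renᶜ (zero ∷ id) (λ _ → refl) J)))))
  where
  collapse : ∀ k M → block (thr k M [ zero ]ᶜ) ⟶* block (thr ((zero ∷ id) k) (M [ zero ]ᶜ))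
  collapse zero    M = done refl
  collapse (suc k) M = block-thr k _

close-where-app : (J : Cmd (suc m) (suc n)) (A B : Val m n) →
                  close J Where (back A · back B) ⟶* close (app (ren id suc A) (ren id suc B) J)
close-where-app J A B = ⟶*-trans (block-where (thr (tail J) (back J)) _)
  (block-⟶* (⟶*-trans (thr-where (tail J) (back J) _) (thr-⟶* (tail J)
    (⟶*-trans (Where⟶*let′ (back J) _)
      (≡⇒⟶* (cong (let′ (back J)) (sym (cong₂ _·_ (back-renᶜ suc (λ _ → refl) A) (back-renᶜ suc (λ _ → refl) B)))))))))

-- `back J` omits the throw to `tail J`, so replacing throws to `k` misses it. At `j = tail J` this
-- supplies the missing `where`.
plug : Fin n → Fin n → Term (suc m) n → Term m n → Term m n
plug j k M N = if does (j ≟ k) then M Where N else N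

throw-plug : (j k : Fin n) (Q : Term m n) (M : Term (suc m) n) →
             throw j Q ⟨throw k ↦ M ⟩ ≡ throw j (plug j k M (Q ⟨throw k ↦ M ⟩))
throw-plug j k Q M with does (j ≟ k)
... | true  = refl
... | false = refl

tail-redirect : (k : Fin n) (P : Cmd (suc m) n) → tail P ≡ k → ∀ j → tail (redirect k P j) ≡ j
tail-redirect k P eq j with j ≟ k
... | yes refl = eq
... | no _     = refl

ren-redirect : (k : Fin n) (P : Cmd (suc m) n) → ∀ j →
               ren (lift 1 suc) id (redirect k P j) ≡ redirect k (ren (lift 1 suc) id P) j
ren-redirect k P j with does (j ≟ k)
... | true  = refl
... | false = refl

ren-redirectᶜ : (k : Fin n) (P : Cmd (suc m) n) → ∀ j →
                (ret zero (atom zero) ∷ (ren (lift 1 suc) suc ∘ redirect k P)) j ≡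
                redirect (suc k) (ren (lift 1 suc) suc P) j
ren-redirectᶜ k P zero = refl
ren-redirectᶜ k P (suc j) with does (j ≟ k)
... | true  = refl
... | false = refl

extk-redirect : {k : Fin n} {P : Cmd (suc m) n} {κ : Fin n → Cmd (suc m) n} → (∀ j → κ j ≡ redirect k P j) →
                ∀ j → extk κ j ≡ redirect k (ren (lift 1 suc) id P) j
extk-redirect q j = trans (cong (ren (lift 1 suc) id) (q j)) (ren-redirect _ _ j)

extkᶜ-redirect : {k : Fin n} {P : Cmd (suc m) n} {κ : Fin n → Cmd (suc m) n} → (∀ j → κ j ≡ redirect k P j) →
                 ∀ j → extkᶜ κ j ≡ redirect (suc k) (ren (lift 1 suc) suc P) j
extkᶜ-redirect q zero    = refl
extkᶜ-redirect q (suc j) = trans (cong (ren (lift 1 suc) suc) (q j)) (ren-redirectᶜ _ _ (suc j))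

ext-atom : {σ : Fin m → Val m n} (θ : Fin n → Fin n′) → (∀ x → σ x ≡ atom x) →
           ∀ x → (atom zero ∷ (ren suc θ ∘ σ)) x ≡ atom x
ext-atom θ p zero    = refl
ext-atom θ p (suc x) = cong (ren suc θ) (p x)

tail-sub : {k : Fin n} {P : Cmd (suc m) n} {σ : Fin m → Val m n} {κ : Fin n → Cmd (suc m) n} →
           tail P ≡ k → (∀ j → κ j ≡ redirect k P j) → (J : Cmd m n) → tail (sub σ κ J) ≡ tail J
tail-sub {k = k} {P} {κ = κ} eq q (ret j W) = trans (tail-subv _ id (κ j)) (trans (cong tail (q j)) (tail-redirect k P eq j))
tail-sub {P = P} eq q (app A B J) = tail-sub (trans (tail-ren (lift 1 suc) id P) eq) (extk-redirect q) J

-- Thus `let′` drops a binding only at a tail call, whose let-body returns at once.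
back-var-zero : (J : Cmd (suc m) n) → back J ≡ var zero → J ≡ ret (tail J) (atom zero)
back-var-zero (ret k (atom zero)) eq = refl
back-var-zero (app A B J) eq with var-zero? (back J)
back-var-zero (app A B J) () | yes _
back-var-zero (app A B J) () | no _

-- Because P returns to k, replacing k by P leaves every tail unchanged and
-- turns  throw k Q  into  throw k (P where x := Q).
replace : {k : Fin n} {P : Cmd (suc m) n} {σ : Fin m → Val m n} {κ : Fin n → Cmd (suc m) n} →
          tail P ≡ k → (∀ x → σ x ≡ atom x) → (∀ j → κ j ≡ redirect k P j) →
          (W : Val m n) → back W ⟨throw k ↦ back P ⟩ ⟶* back (sub σ κ W)
replaceᶜ : {k : Fin n} {P : Cmd (suc m) n} {σ : Fin m → Val m n} {κ : Fin n → Cmd (suc m) n} →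
           tail P ≡ k → (∀ x → σ x ≡ atom x) → (∀ j → κ j ≡ redirect k P j) →
           (J : Cmd m n) → plug (tail J) k (back P) (back J ⟨throw k ↦ back P ⟩) ⟶* back (sub σ κ J)
replaceᶜ-let : {k : Fin n} {P : Cmd (suc m) n} {σ : Fin m → Val m n} {κ : Fin n → Cmd (suc m) n} →
               tail P ≡ k → (∀ x → σ x ≡ atom x) → (∀ j → κ j ≡ redirect k P j) →
               (J : Cmd (suc m) n) → plug (tail J) k (rename (lift 1 suc) (back P)) (back J ⟨throw k ↦ rename (lift 1 suc) (back P) ⟩)
                 ⟶* back (sub (extv σ) (extk κ) J)

replace eq p q (atom x) = ≡⇒⟶* (sym (cong back (p x)))
replace {k = k} {P} {σ} {κ} eq p q (lam J) = ƛ-⟶* (⟶*-trans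
  (block-throw-↦ (thr (tail J) (back J)) k _)
  (block-⟶* (⟶*-trans (≡⇒⟶* (cong (thr (tail J) (back J) ⟨throw suc k ↦_⟩) (sym (back-ren (lift 1 suc) suc P))))
    (⟶*-trans (inner (tail J) (back J) (replaceᶜ eq′ (ext-atom suc p) (extkᶜ-redirect q) J))
      (≡⇒⟶* (cong (λ j → thr j (back (sub (extvᶜ σ) (extkᶜ κ) J))) (sym (tail-sub eq′ (extkᶜ-redirect q) J))))))))
  where
  eq′ : tail (ren (lift 1 suc) suc P) ≡ suc k
  eq′ = trans (tail-ren (lift 1 suc) suc P) (cong suc eq)
  inner : ∀ j (M : Term _ _) {N} → plug j (suc k) (back (ren (lift 1 suc) suc P)) (M ⟨throw suc k ↦ back (ren (lift 1 suc) suc P) ⟩) ⟶* N →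
          thr j M ⟨throw suc k ↦ back (ren (lift 1 suc) suc P) ⟩ ⟶* thr j N
  inner zero    M r = r
  inner (suc j) M r = ⟶*-trans (≡⇒⟶* (throw-plug (suc j) (suc k) M _)) (throw-⟶* r)

replaceᶜ {k = k} {P} {σ} {κ} eq p q (ret j W) = ⟶*-trans core
  (≡⇒⟶* (sym (trans (cong (back ∘ subv _ id) (q j)) (back-subv back-∷ (λ _ → refl) (redirect k P j)))))
  where
  V = back (sub σ κ W)
  back-∷ : ∀ x → back ((sub σ κ W ∷ atom) x) ≡ (V ∷ var) x
  back-∷ zero    = refl
  back-∷ (suc x) = refl
  core : plug j k (back P) (back W ⟨throw k ↦ back P ⟩) ⟶* back (redirect k P j) [ V ]
  core with does (j ≟ k)
  -- `where-value` is the source form of the contraction that `sub` makes at `ret`.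
  ... | true  = ⟶*-trans (Where-⟶* (done refl) (replace eq p q W)) (rule (where-value (back P) (back-value (sub σ κ W))))
  ... | false = replace eq p q W
replaceᶜ {k = k} {P} {σ} {κ} eq p q (app A B J) with var-zero? (back J)
... | yes e rewrite back-var-zero J e = last (tail J)
  where
  args : (back A · back B) ⟨throw k ↦ back P ⟩ ⟶* back (sub σ κ A) · back (sub σ κ B)
  args = ·-⟶* (replace eq p q A) (replace eq p q B)
  last : ∀ j → plug j k (back P) ((back A · back B) ⟨throw k ↦ back P ⟩) ⟶*
         let′ (back (subv (atom zero ∷ atom) id (extk κ j))) (back (sub σ κ A) · back (sub σ κ B))
  -- The let-body of a tail call is the identity, so its image under the substitution is `κ j`
  -- itself.
  last j rewrite subv-lift-suc (κ j) | q j with does (j ≟ k)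
  ... | true  = ⟶*-trans (Where-⟶* (done refl) args) (Where⟶*let′ (back P) _)
  ... | false = args
... | no ¬e = ⟶*-trans (shift (tail J)) (⟶*-trans (Where-⟶* (replaceᶜ-let eq p q J) args) (Where⟶*let′ _ _))
  where
  args : (back A · back B) ⟨throw k ↦ back P ⟩ ⟶* back (sub σ κ A) · back (sub σ κ B)
  args = ·-⟶* (replace eq p q A) (replace eq p q B)
  shift : ∀ j {M N} → plug j k (back P) (M Where N) ⟶* plug j k (rename (lift 1 suc) (back P)) M Where N
  shift j with does (j ≟ k)
  -- The new `where` moves past the call, to the end of the chain where the omitted throw of `J`
  -- belongs.
  ... | true  = structural (where-where (back P) _ _)
  ... | false = done refl

replaceᶜ-let {k = k} {P} {σ} {κ} eq p q J = ≡.subst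
  (λ M → plug (tail J) k M (back J ⟨throw k ↦ M ⟩) ⟶* back (sub (extv σ) (extk κ) J))
  (back-renᵛ (lift 1 suc) P)
  (replaceᶜ (trans (tail-ren (lift 1 suc) id P) eq) (ext-atom id p) (extk-redirect q) J)

redirect-zero : (P : Cmd (suc m) (suc n)) → ∀ j → (P ∷ retk suc) j ≡ redirect zero P j
redirect-zero P zero    = refl
redirect-zero P (suc j) = refl

-- `replace` asks that the let-body return to the continuation it replaces, here index zero of `J`.
-- `untail K` does, and it reads back as `back K`, weakened.
back-where-close : (K : Cmd (suc m) n) (J : Cmd m (suc n)) → back K Where close J ⟶* close (bind J (untail K))
back-where-close {m} {n} K J = ⟶*-trans (where-block (back K) (thr (tail J) (back J)))
  (block-⟶* (⟶*-trans (≡⇒⟶* (cong (λ M → M Where (thr (tail J) (back J) ⟨throw zero ↦ M ⟩)) (sym (back-untail K))))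
    (⟶*-trans (inner (tail J) (back J) (replaceᶜ (tail-untail K) (λ _ → refl) (redirect-zero (untail K)) J))
      (≡⇒⟶* (cong (λ j → thr j (back (bind J (untail K)))) (sym (tail-sub (tail-untail K) (redirect-zero (untail K)) J)))))))
  where
  P = back (untail K)
  inner : ∀ j (M : Term m (suc n)) {N} → plug j zero P (M ⟨throw zero ↦ P ⟩) ⟶* N →
          P Where (thr j M ⟨throw zero ↦ P ⟩) ⟶* thr j N
  inner zero    M r = r
  inner (suc j) M r = ⟶*-trans (rule (where-throw P (suc j) _)) (throw-⟶* r)

-- The block and the final throw of `K` move out of the `where` by the structural congruence. What
-- remains is combined with a fresh tail, which `block-thr-close` renames to that of `K`.
close-where-close : (K : Cmd (suc m) (suc n)) (J : Cmd m (suc n)) → close K Where close J ⟶* close (bind J K)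
close-where-close K J = ⟶*-trans (block-where (thr (tail K) (back K)) (close J))
  (⟶*-trans (block-⟶* (⟶*-trans (thr-where (tail K) (back K) _) (thr-⟶* (tail K)
    (⟶*-trans (≡⇒⟶* (cong (back K Where_) (sym (trans (close-ren id suc J) (cong weakenᶜ (rename-id (λ _ → refl) (close J)))))))
              (back-where-close K (ren id (lift 1 suc) J))))))
  (⟶*-trans (block-thr-close (tail K) (bind (ren id (lift 1 suc) J) (untail K)))
    (≡⇒⟶* (cong close (trans
      (cong (ren id (tail K ∷ id)) (sub-ren (λ _ → refl) (λ _ → refl) J))
      (ren-sub (λ _ → refl) (λ { zero → retail (lift-id (λ _ → refl)) K ; (suc k) → refl }) J))))))

-- Every other command reads back as an application, a `where`, a `throw` or an `ε`.
close-value : (J : Cmd m (suc n)) → Value (close J) → ∃[ W ] (J ≡ ret zero W × back W ≡ weakenᶜ (close J))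
close-value J v with close J | block-view (thr (tail J) (back J))
close-value (ret zero W) v | N | unused eq = W , refl , eq
close-value (ret (suc k) W) (var x) | _ | unused ()
close-value (ret (suc k) W) (ƛ M) | _ | unused ()
close-value (app A B J) v | N | unused eq with tail J | var-zero? (back J)
close-value (app A B J) (var x) | _ | unused () | zero | yes _
close-value (app A B J) (ƛ M) | _ | unused () | zero | yes _
close-value (app A B J) (var x) | _ | unused () | zero | no _
close-value (app A B J) (ƛ M) | _ | unused () | zero | no _
close-value (app A B J) (var x) | _ | unused () | suc k | _
close-value (app A B J) (ƛ M) | _ | unused () | suc k | _

value? : (M : Term m n) → Dec (Value M)
value? (var x)     = yes (var x)
value? (ƛ M)       = yes (ƛ M)
value? (_ · _)     = no λ ()
value? (_ Where _) = no λ ()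
value? (ε _)       = no λ ()
value? (throw _ _) = no λ ()

close-ret : (W : Val m n) → close (ret zero (ren id suc W)) ≡ back W
close-ret W = block-unique (unused (back-renᶜ suc (λ _ → refl) W))

close-call : (A B : Val m n) → close (call (ren id suc A) (ren id suc B)) ≡ back A · back B
close-call A B = block-unique (unused (cong₂ _·_ (back-renᶜ suc (λ _ → refl) A) (back-renᶜ suc (λ _ → refl) B)))

-- The argument may have become a value, to which `value-app` does not apply; the call then has to
-- be matched directly.
value·close : (A : Val m n) (J : Cmd m (suc n)) →
              back A · close J ⟶* close (bind J (call (ren suc id (ren id suc A)) (atom zero)))
value·close A J with value? (close J)
... | no nv = ⟶*-trans (rule (value-app (back-value A) nv))
  (⟶*-trans (Where-⟶* (≡⇒⟶* (sym (trans (cong (λ V → close (call V (atom zero))) (ren-comm {ρ₃ = suc} {ρ₄ = id} {θ₃ = id} (λ _ → refl) (λ _ → refl) A))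
      (trans (close-call (ren suc id A) (atom zero)) (cong (_· var zero) (back-renᵛ suc A)))))) (done refl))
    (close-where-close (call (ren suc id (ren id suc A)) (atom zero)) J))
... | yes v with close-value J v
-- It is the readback of `B` that is known to omit the return continuation, so `replace` is used
-- with a replacement that has no effect on `back B`.
... | B , refl , eq = ⟶*-trans
  (≡⇒⟶* (sym (block-unique (unused (cong₂ _·_ (back-renᶜ suc (λ _ → refl) A) (refl {x = weakenᶜ (close J)}))))))
  (block-⟶* (·-⟶* (≡⇒⟶* (cong back (sym (subv-weaken (ren id suc A)))))
    (⟶*-trans (≡⇒⟶* (sym (trans (cong (_⟨throw zero ↦ back K ⟩) eq) (throw-↦-unused (λ _ ()) (close J) (back K)))))
      (replace refl (λ _ → refl) (redirect-zero K) B))))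
  where K = call (ren suc id (ren id suc A)) (atom zero)

reaches-close : (M : Term m n) → M ⟶* close ⟦ M ⟧
reaches-close (var x) = ≡⇒⟶* (sym (block-weakenᶜ (var x)))
reaches-close (ƛ M) = ⟶*-trans (ƛ-⟶* (reaches-close M)) (≡⇒⟶* (sym (close-ret (lam ⟦ M ⟧))))
reaches-close (M · N) with value? M
... | yes v = ⟶*-trans (·-⟶* (reaches-close M) (reaches-close N))
  (⟶*-trans (≡⇒⟶* (cong (_· close ⟦ N ⟧) (trans (cong close (⟦value⟧ v)) (close-ret (valueOf v)))))
  (⟶*-trans (value·close (valueOf v) ⟦ N ⟧) (≡⇒⟶* (cong close (sym (⟦value-app⟧ v N))))))
-- `M` is reduced only after `nonvalue-app`: its reduct may be a value, which that rule excludes.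
... | no nv = ⟶*-trans (·-⟶* (done refl) (reaches-close N))
  (⟶*-trans (rule (nonvalue-app (close ⟦ N ⟧) nv))
  (⟶*-trans (Where-⟶*
      (⟶*-trans (≡⇒⟶* (cong (var zero ·_) (sym (close-renᵛ ⟦ N ⟧)))) (value·close (atom zero) (ren suc id ⟦ N ⟧)))
      (reaches-close M))
    (close-where-close (bind (ren suc id ⟦ N ⟧) call₁₀) ⟦ M ⟧)))
  where
  close-renᵛ : (J : Cmd m (suc n)) → close (ren suc id J) ≡ weaken (close J)
  close-renᵛ J = trans (cong close (ren-ext (λ _ → refl) id≗lift-id J))
    (trans (close-ren suc id J) (renameᶜ-id (λ _ → refl) _))
reaches-close (L Where M) = ⟶*-trans (Where-⟶* (reaches-close L) (reaches-close M)) (close-where-close ⟦ L ⟧ ⟦ M ⟧)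
reaches-close (ε M) = ⟶*-trans (ε-⟶* (reaches-close M))
  (⟶*-trans (ε⟶*block (close ⟦ M ⟧)) (block-thr-close zero ⟦ M ⟧))
reaches-close (throw k M) = ⟶*-trans (throw-⟶* (reaches-close M))
  (⟶*-trans (throw-close k ⟦ M ⟧)
    (≡⇒⟶* (sym (trans (cong close (sym (ren-ren {ρ₁ = id} {ρ₂ = id} {θ₁ = k ∷ id} {θ₂ = suc} (λ _ → refl) (λ { zero → refl ; (suc l) → refl }) ⟦ M ⟧)))
      (block-unique (unused (weaken-thr (ren id (k ∷ id) ⟦ M ⟧))))))))
  where
  weaken-thr : (J : Cmd m n) → thr (tail (ren id suc J)) (back (ren id suc J)) ≡ weakenᶜ (throw (tail J) (back J))
  weaken-thr J rewrite tail-ren id suc J = cong (throw _) (back-renᶜ suc (λ _ → refl) J)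

-- Readback of target reductions

β-close : (J : Cmd (suc m) (suc n)) (W : Val m n) →
          (ƛ close J) · back W ⟶* close (subv (ren id suc W ∷ atom) id J)
β-close J W = ⟶*-trans (rule (β (close J) (back-value W)))
  (⟶*-trans (rule (where-value (close J) (back-value W)))
    (≡⇒⟶* (sym (close-subv (λ { zero → back-renᶜ suc (λ _ → refl) W ; (suc x) → refl }) (λ _ → refl) J))))

back-⇉ : {W W′ : Val m n} → W ⇉ W′ → back W ⟶* back W′
-- A step of J may duplicate its tail k.  Read back, the copies appear below an ε, so the
-- reduct J″ has a fresh tail, to be identified with k.
back-⇉ᶜ : {J J′ : Cmd m n} → J ⇉ J′ → ∃[ J″ ] (back J ⟶* close J″ × ren id (tail J ∷ id) J″ ≡ J′)
close-⇉ : {J J′ : Cmd m (suc n)} → J ⇉ J′ → close J ⟶* close J′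

close-⇉ {J = J} d with back-⇉ᶜ d
... | J″ , r , refl = ⟶*-trans (block-⟶* (thr-⟶* (tail J) r)) (block-thr-close (tail J) J″)

back-⇉ atom    = done refl
back-⇉ (lam d) = ƛ-⟶* (close-⇉ d)
back-⇉ (η {W = W} refl d) = ⟶*-trans
  (≡⇒⟶* (cong ƛ_ (block-unique (unused (cong (_· var zero) (back-ren suc suc W))))))
  (⟶*-trans (rule (η (back-value W))) (back-⇉ d))

back-⇉ᶜ (ret {k = k} {W′ = W′} d) = untail (ret k W′) ,
  ⟶*-trans (back-⇉ d) (≡⇒⟶* (sym (close-untail (ret k W′)))) , retail (λ _ → refl) (ret k W′)
back-⇉ᶜ (app {A = A} {A′} {B} {B′} {K} {K′} a b d) with var-zero? (back K) | back-⇉ᶜ d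
... | no _ | K″ , r , eq = app (ren id suc A′) (ren id suc B′) K″ ,
  ⟶*-trans (Where-⟶* r (·-⟶* (back-⇉ a) (back-⇉ b))) (close-where-app K″ A′ B′) ,
  cong₃ app (ren-retract (λ _ → refl) A′) (ren-retract (λ _ → refl) B′)
            (trans (ren-ext (lift-id (λ _ → refl)) (λ _ → refl) K″) eq)
-- At a tail call `let′` has dropped the `where`, so the application stands alone; the let-body
-- `ret k (atom zero)` steps only to itself.
... | yes e | _ with back-var-zero K e
back-⇉ᶜ (app {A′ = A′} {B′ = B′} a b (ret {k = k} atom)) | yes e | _ | refl =
  untail (app A′ B′ K₀) , ⟶*-trans (·-⟶* (back-⇉ a) (back-⇉ b)) (≡⇒⟶* (sym (close-untail (app A′ B′ K₀)))) ,
  retail (λ _ → refl) (app A′ B′ K₀)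
  where K₀ = ret k (atom zero)
back-⇉ᶜ (β {J′ = J′} {W′ = W′} {K = K} j w d refl) with var-zero? (back K) | back-⇉ᶜ d
-- The contraction is split: `β-close` puts in the argument, giving `J₂`, and `close-where-close`
-- then puts `K″` in place of its return continuation.
... | no _ | K″ , r , refl = bind J₂ K″ ,
  ⟶*-trans (Where-⟶* r (⟶*-trans (·-⟶* (ƛ-⟶* (close-⇉ j)) (back-⇉ w)) (β-close J′ W′))) (close-where-close K″ J₂) ,
  trans (cong (ren id (tail K ∷ id)) (sub-subv {σ′ = ren id suc W′ ∷ atom}
          (λ { zero → bind-weaken K″ W′ ; (suc x) → refl }) (λ _ → refl) J′))
    (ren-sub (λ { zero → ren-retract (λ _ → refl) W′ ; (suc x) → refl })
             (λ { zero → ren-ext (lift-id (λ _ → refl)) (λ _ → refl) K″ ; (suc k) → refl }) J′)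
  where J₂ = subv (ren id suc W′ ∷ atom) id J′
... | yes e | _ with back-var-zero K e
back-⇉ᶜ (β {J′ = J′} {W′ = W′} j w (ret {k = k} atom) refl) | yes e | _ | refl =
  subv (ren id suc W′ ∷ atom) id J′ ,
  ⟶*-trans (·-⟶* (ƛ-⟶* (close-⇉ j)) (back-⇉ w)) (β-close J′ W′) ,
  trans (ren-subv (λ { zero → ren-retract (λ _ → refl) W′ ; (suc x) → refl }) (λ _ → refl) J′)
        (sym (sub-retk (λ _ → refl) (λ { zero → refl ; (suc l) → refl }) J′))

close-⇉* : {J J′ : Cmd m (suc n)} → J ⇉* J′ → close J ⟶* close J′
close-⇉* []       = done refl
close-⇉* (d ◅ ds) = ⟶*-trans (close-⇉ d) (close-⇉* ds)

theorem4p6 : ∀ {m n : ℕ} (M₁ M₂ : Term m n) → M₁ ≈ M₂ → ∃[ N ] (M₁ ⟶* N × M₂ ⟶* N)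
theorem4p6 M₁ M₂ p with ⟦≈⟧ p
... | J , ds , es = close J , ⟶*-trans (reaches-close M₁) (close-⇉* ds) ,
                              ⟶*-trans (reaches-close M₂) (close-⇉* es)
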